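{- Let $n\ge 1$. The Hilbert series of $EQH_n$ is $$\mathrm{Hilb}_{EQH_n}(q)=\sum_{k=0}^{\lfloor n/2\rfloor} f^{(n-k,k)}q^k,$$ where $f^{(n-k,k)}$ is the number of standard Young tableaux of shape $(n-k,k)$.
   Context: Let $R_n=\mathbb{Q}[\theta_1,\dots,\theta_n]$ be the polynomial ring in anticommuting variables over $\mathbb{Q}$ (exterior algebra): $\theta_i\theta_j=-\theta_j\theta_i$ for $i\ne j$, $\theta_i^2=0$, graded by degree. For $A=\{a_1<\cdots<a_r\}\subseteq[n]$ put $\theta_A=\theta_{a_1}\cdots\theta_{a_r}$, and $F_{1^r}=\sum_{A\subseteq[n],|A|=r}\theta_A$. Let $I_n$ be the ideal of $R_n$ generated by $F_{1^r}$, $1\le r\le n$. Operators $\partial_{\theta_i}$ on $R_n$: $\partial_{\theta_i}(\theta_A)=(-1)^{\#\{j\in A: j<i\}}\theta_{A\setminus\{i\}}$ if $i\in A$, and $0$ otherwise. The inner product on $R_n$ is $\langle p,q\rangle=\overline{p(\partial_{\theta_1},\dots,\partial_{\theta_n})}\,q(\theta_1,\dots,\theta_n)|_{\theta_1=\cdots=\theta_n=0}$, where the bar reverses the order of the factors in every monomial; the monomials $\theta_A$ are an orthonormal basis for it. Define $EQH_n=\{q\in R_n:\langle p,q\rangle=0\text{ for all }p\in I_n\}$, a graded subspace of $R_n$. The Hilbert series of a graded space $V=\bigoplus_k V_k$ is $\sum_k \dim(V_k)q^k$. -}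

module Defs where

open import Data.Bool.Base using (if_then_else_)
open import Data.Bool.Properties using () renaming (_≟_ to _≟ᵇ_)
open import Data.Fin.Base as Fin using (Fin; zero; suc; toℕ)
import Data.Fin.Properties as Fin
open import Data.Fin.Subset using (Subset; inside; outside; ⊥; ∣_∣; _∪_; _∩_; _-_)
open import Data.Fin.Subset.Properties using (_∈?_; nonempty?)
open import Data.List.Base as List
  using (List; []; _∷_; allFin; applyUpTo; cartesianProductWith; filter; foldr; length; reverse)
open import Data.List.Membership.Propositional.Properties using (∈-lookup)
open import Data.List.Relation.Unary.All as All using (All; []; _∷_)
open import Data.Nat.Base as ℕ using (ℕ; zero; suc; _≡ᵇ_)
open import Data.Nat.ListAction using (sum)
import Data.Nat.Properties as ℕ
open import Data.Product.Base using (Σ; ∃; _×_; _,_; curry; uncurry)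
open import Data.Product.Properties using () renaming (≡-dec to Σ-≡-dec)
open import Data.Rational.Base using (ℚ; 0ℚ; 1ℚ; _+_; _*_; -_)
open import Data.Rational.Properties using (+-0-commutativeMonoid)
open import Algebra.Properties.CommutativeMonoid.Sum +-0-commutativeMonoid
  using () renaming (sum to ∑Fin)
open import Data.Vec.Base as Vec using (Vec; []; _∷_)
open import Data.Vec.Properties using (≡-dec)
open import Function.Base using (_∘_)
open import Function.Consequences.Propositional
  using (strictlySurjective⇒surjective; surjective⇒strictlySurjective)
open import Function.Definitions using (Injective; Surjective; Bijective)
open import Relation.Binary.PropositionalEquality using (_≡_; _≢_)
open import Relation.Nullary.Decidable using (Dec; does; map′; _×-dec_; _→-dec_)
open import Relation.Unary using (Decidable)

-- An element is given by its coefficients in the basis of monomials θ_A;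
-- the equality of the algebra is the pointwise one.

R : ℕ → Set
R n = Subset n → ℚ

infix 4 _≈_

_≈_ : ∀ {n} → R n → R n → Set
p ≈ q = ∀ A → p A ≡ q A

∑ : ∀ {n} → (Subset n → ℚ) → ℚ
∑ {zero}  f = f []
∑ {suc n} f = ∑ (λ A → f (outside ∷ A)) + ∑ (λ A → f (inside ∷ A))

𝟎 : ∀ {n} → R n
𝟎 _ = 0ℚ

θ : ∀ {n} → Subset n → R n
θ A B = if does (≡-dec _≟ᵇ_ A B) then 1ℚ else 0ℚ

infixl 6 _⊕_
infixl 7 _•_ _⊛_

_⊕_ : ∀ {n} → R n → R n → R n
(p ⊕ q) A = p A + q A

_•_ : ∀ {n} → ℚ → R n → R n
(c • p) A = c * p A

-- The linear map sending θ_A to f A.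
linear : ∀ {m n} → (Subset m → R n) → R m → R n
linear f p B = ∑ (λ A → p A * f A B)

-1^_ : ℕ → ℚ
-1^ zero    = 1ℚ
-1^ (suc k) = - (-1^ k)

-- The number of pairs (a , b) with a ∈ A, b ∈ B and a > b, i.e. the number
-- of transpositions needed to sort the word θ_A θ_B.
inversions : ∀ {n} → Subset n → Subset n → ℕ
inversions []      []      = 0
inversions (_ ∷ A) (b ∷ B) = (if b then ∣ A ∣ else 0) ℕ.+ inversions A B

mulMonomials : ∀ {n} → Subset n → Subset n → R n
mulMonomials A B =
  if does (nonempty? (A ∩ B)) then 𝟎 else (-1^ inversions A B) • θ (A ∪ B)

_⊛_ : ∀ {n} → R n → R n → R n
p ⊛ q = linear (λ A → linear (λ B → mulMonomials A B) q) p

F : ∀ {n} → ℕ → R n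
F r B = ∑ (λ A → if ∣ A ∣ ≡ᵇ r then θ A B else 0ℚ)

data Ideal⟨_⟩ {n} (G : R n → Set) : R n → Set where
  gen  : ∀ {p} → G p → Ideal⟨ G ⟩ p
  zero : Ideal⟨ G ⟩ 𝟎
  add  : ∀ {p q} → Ideal⟨ G ⟩ p → Ideal⟨ G ⟩ q → Ideal⟨ G ⟩ (p ⊕ q)
  mulˡ : ∀ p {q} → Ideal⟨ G ⟩ q → Ideal⟨ G ⟩ (p ⊛ q)
  mulʳ : ∀ {p} q → Ideal⟨ G ⟩ p → Ideal⟨ G ⟩ (p ⊛ q)
  resp : ∀ {p q} → p ≈ q → Ideal⟨ G ⟩ p → Ideal⟨ G ⟩ q

I : ∀ n → R n → Set
I n = Ideal⟨ (λ p → ∃ λ r → 1 ℕ.≤ r × r ℕ.≤ n × p ≡ F r) ⟩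

-- The number of j ∈ A with j < i.
countBelow : ∀ {n} → Fin n → Subset n → ℕ
countBelow zero    _       = 0
countBelow (suc i) (a ∷ A) = (if a then 1 else 0) ℕ.+ countBelow i A

∂ : ∀ {n} → Fin n → R n → R n
∂ i = linear λ A →
  if does (i ∈? A) then (-1^ countBelow i A) • θ (A - i) else 𝟎

elements : ∀ {n} → Subset n → List (Fin n)
elements {n} A = filter (_∈? A) (allFin n)

-- ∂-word (i₁ ∷ … ∷ iᵣ ∷ []) is the composite ∂_{i₁} ∘ … ∘ ∂_{iᵣ}.
∂-word : ∀ {n} → List (Fin n) → R n → R n
∂-word is q = foldr ∂ q is

-- Evaluation at θ₁ = … = θₙ = 0 is the coefficient of θ_∅ = 1.  The reversal
-- of the word is the bar.
⟨_,_⟩ : ∀ {n} → R n → R n → ℚ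
⟨ p , q ⟩ = ∑ (λ A → p A * ∂-word (reverse (elements A)) q ⊥)

EQH : ∀ n → R n → Set
EQH n q = ∀ p → I n p → ⟨ p , q ⟩ ≡ 0ℚ

linComb : ∀ {n d} → (Fin d → ℚ) → (Fin d → R n) → R n
linComb c v A = ∑Fin (λ i → c i * v i A)

record HasDim {n} (V : R n → Set) (d : ℕ) : Set where
  field
    basis       : Fin d → R n
    basis∈V     : ∀ i → V (basis i)
    independent : ∀ c → linComb c basis ≈ 𝟎 → ∀ i → c i ≡ 0ℚ
    spanning    : ∀ v → V v → ∃ λ c → v ≈ linComb c basis

Homogeneous : ∀ {n} → ℕ → R n → Set
Homogeneous k p = ∀ A → ∣ A ∣ ≢ k → p A ≡ 0ℚ

-- A power series in q with natural number coefficients; h k is the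
-- coefficient of q^k.
Series : Set
Series = ℕ → ℕ

infix 8 _·q^_

_·q^_ : ℕ → ℕ → Series
(c ·q^ k) j = if j ≡ᵇ k then c else 0

∑[k≤_]_ : ℕ → (ℕ → Series) → Series
(∑[k≤ m ] s) j = sum (applyUpTo (λ k → s k j) (suc m))

-- For a graded subspace V, the homogeneous component V_k is V ∩ R_k.
HasHilb : ∀ {n} → (R n → Set) → Series → Set
HasHilb V h = ∀ k → HasDim (λ p → V p × Homogeneous k p) (h k)

-- A shape is the list of its row lengths; empty rows are allowed.
Shape : Set
Shape = List ℕ

Cell : Shape → Set
Cell λs = Σ (Fin (length λs)) (Fin ∘ List.lookup λs)

-- Fillings of the cells with N symbols, stored row by row; with
-- N = sum λs, the element i of Fin N stands for the entry i + 1.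
Filling : ℕ → Shape → Set
Filling N λs = All (Vec (Fin N)) λs

entry : ∀ {N λs} → Filling N λs → Cell λs → Fin N
entry T (i , j) = Vec.lookup (All.lookup T (∈-lookup i)) j

RowIncreasing : ∀ {N λs} → Filling N λs → Set
RowIncreasing {λs = λs} T =
  ∀ i (j j′ : Fin (List.lookup λs i)) → j Fin.< j′ →
  entry T (i , j) Fin.< entry T (i , j′)

ColumnIncreasing : ∀ {N λs} → Filling N λs → Set
ColumnIncreasing {λs = λs} T =
  ∀ i i′ (j : Fin (List.lookup λs i)) (j′ : Fin (List.lookup λs i′)) →
  i Fin.< i′ → toℕ j ≡ toℕ j′ →
  entry T (i , j) Fin.< entry T (i′ , j′)

IsStandard : ∀ {λs} → Filling (sum λs) λs → Set
IsStandard T =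
  Bijective _≡_ _≡_ (entry T) × RowIncreasing T × ColumnIncreasing T

module _ {λs : Shape} where

  allCells? : {P : Cell λs → Set} → Decidable P → Dec (∀ c → P c)
  allCells? P? = map′ uncurry curry
    (Fin.all? λ i → Fin.all? λ j → P? (i , j))

  anyCell? : {P : Cell λs → Set} → Decidable P → Dec (∃ P)
  anyCell? P? = map′ (λ (i , j , p) → (i , j) , p) (λ ((i , j) , p) → i , j , p)
    (Fin.any? λ i → Fin.any? λ j → P? (i , j))

  injective? : ∀ {N} (f : Cell λs → Fin N) → Dec (Injective _≡_ _≡_ f)
  injective? f = map′ (λ inj {c} {c′} → inj c c′) (λ inj c c′ → inj {c} {c′})
    (allCells? λ c → allCells? λ c′ →
      (f c Fin.≟ f c′) →-dec Σ-≡-dec Fin._≟_ Fin._≟_ c c′)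

  surjective? : ∀ {N} (f : Cell λs → Fin N) → Dec (Surjective _≡_ _≡_ f)
  surjective? f = map′ strictlySurjective⇒surjective surjective⇒strictlySurjective
    (Fin.all? λ y → anyCell? λ c → f c Fin.≟ y)

isStandard? : ∀ {λs} → Decidable (IsStandard {λs})
isStandard? {λs} T =
  (injective? {λs} (entry T) ×-dec surjective? {λs} (entry T))
  ×-dec (Fin.all? λ i → Fin.all? λ j → Fin.all? λ j′ →
          (j Fin.<? j′) →-dec (entry T (i , j) Fin.<? entry T (i , j′)))
  ×-dec (Fin.all? λ i → Fin.all? λ i′ → Fin.all? λ j → Fin.all? λ j′ →
          (i Fin.<? i′) →-dec ((toℕ j ℕ.≟ toℕ j′) →-dec
          (entry T (i , j) Fin.<? entry T (i′ , j′))))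

allVecs : ∀ {A : Set} → List A → ∀ n → List (Vec A n)
allVecs xs zero    = [] ∷ []
allVecs xs (suc n) = cartesianProductWith _∷_ xs (allVecs xs n)

allFillings : ∀ N λs → List (Filling N λs)
allFillings N []       = [] ∷ []
allFillings N (r ∷ λs) =
  cartesianProductWith _∷_ (allVecs (allFin N) r) (allFillings N λs)

f^_ : Shape → ℕ
f^ λs = length (filter isStandard? (allFillings (sum λs) λs))

{-# OPTIONS --safe #-}

-- The ideal I n is orthogonal to q exactly when q is killed by the contractions D and W
-- adjoint to the multiplications by F 1 and F 2, because F (2k + 1) = F 1 F (2k) and
-- (k + 1) F (2k + 2) = F 2 F (2k).  Writing an element of R (n + 1) as v₀ + θ₁ v₁, the
-- conditions D v = W v = 0 become v₁ = - D v₀ and W v₀ = 0.  Hence v ↦ v₁ maps the part of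
-- degree k of EQH (n + 1) to the part of degree k - 1 of EQH n, with kernel the part of
-- degree k of EQH n.  This map is onto when 2k ≤ n + 1, and the source vanishes
-- when 2k > n + 1: both follow from a Lefschetz property, that W^r is onto, respectively
-- injective, on the appropriate degrees, which is proved by splitting off two variables.
-- The resulting recursion is that of the ballot sequences, which number the standard
-- Young tableaux with two rows by recording the row of each entry.
module Submission where

open import Defs
open import Algebra.Bundles using (AbelianGroup)
import Algebra.Properties.AbelianGroup as AbelianGroupProperties
open import Data.Bool.Base using (true; false; if_then_else_)
open import Data.Bool.Properties using (if-float)
open import Data.Fin.Base as Fin using (Fin; zero; suc; toℕ; fromℕ<)
import Data.Fin.Properties as Fin
open import Data.Fin.Subset using (Subset; inside; outside; ⊥; ∣_∣; _∪_; _∩_; _-_; Nonempty)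
open import Data.Fin.Subset.Properties using (_∈?_; nonempty?; p─⊥≡p)
open import Data.List.Base as List using (List; []; _∷_)
open import Data.List.Membership.Propositional using (_∈_)
open import Data.List.Membership.Propositional.Properties
  using (∈-map⁺; ∈-map⁻; ∈-++⁺ˡ; ∈-++⁺ʳ; ∈-filter⁺; ∈-filter⁻; ∈-cartesianProductWith⁺; ∈-allFin)
open import Data.List.Membership.Propositional.Properties.WithK using (unique∧set⇒bag)
import Data.List.Properties as List
open import Data.List.Relation.Binary.BagAndSetEquality using (∼bag⇒↭)
open import Data.List.Relation.Binary.Permutation.Propositional.Properties using (↭-length)
open import Data.List.Relation.Unary.All using ([]; _∷_)
open import Data.List.Relation.Unary.AllPairs using ([]; _∷_)
open import Data.List.Relation.Unary.Any using (here)
open import Data.List.Relation.Unary.Unique.Propositional using (Unique)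
import Data.List.Relation.Unary.Unique.Propositional.Properties as Unique
open import Data.Nat.Base as ℕ
  using (ℕ; zero; suc; _≤_; _<_; _∸_; z≤n; s≤s; _≡ᵇ_; ⌊_/2⌋; ⌈_/2⌉)
open import Data.Nat.ListAction using (sum)
import Data.Nat.Properties as ℕ
open import Data.Nat.Tactic.RingSolver using (solve-∀)
open import Data.Product.Base using (_×_; _,_; proj₁; proj₂; ∃-syntax)
open import Data.Rational.Base as ℚ using (ℚ; 0ℚ; 1ℚ; _+_; _*_; -_)
import Data.Rational.Properties as ℚ
open import Data.Rational.Solver using (module +-*-Solver)
open +-*-Solver using (solve; _:+_; _:*_; :-_; _:=_; con)
open import Data.Sum.Base as Sum using (_⊎_; inj₁; inj₂)
open import Data.Vec.Base as Vec using (Vec; []; _∷_; _++_; map; replicate; lookup; here; there)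
import Data.Vec.Properties as Vec
open import Data.Vec.Relation.Unary.All as All using (All; []; _∷_)
import Data.Vec.Relation.Unary.All.Properties as All
open import Function.Base using (_∘_)
open import Function.Bundles using (_⇔_; mk⇔; module Equivalence)
open import Relation.Binary.Definitions using (tri<; tri≈; tri>)
open import Relation.Binary.PropositionalEquality
open import Relation.Nullary.Decidable using (yes; no; does; does-⇔)
open import Relation.Nullary.Negation using (contradiction; ¬_)

-- The recursion uses `W` itself, but the Lefschetz argument has to treat all its powers at once:
-- removing two variables from `W^(r+1)` leaves one problem for `W^(r+2)`, two for `W^(r+1)` and one
-- for `W^r`. The bounds compare `2k` with `n + 2(r + s)`; at equality the degree `k - s` of the
-- source and the degree `k - s - 2r` of the target are symmetric about `n/2`. This balance is
-- inherited exactly by all four smaller problems. Removing a single variable would make one of its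
-- two components miss the bound by one. This is a parity effect: the skew form behind F 2 has all
-- entries 1 above the diagonal and is nondegenerate only in an even number of variables. Degrees
-- are recorded by a fixed `k` and an offset `s` that grows on passing to a θ₁-component, so that
-- degree -1 needs no separate treatment. Nested pairs turn every operator into a recursive block
-- formula, and make equality of elements propositional where it is pointwise for coefficient
-- functions.

private variable
  n : ℕ

-- (a , b) stands for a + θ₁ b, with a and b in the remaining variables.
Λ : ℕ → Set
Λ zero    = ℚ
Λ (suc n) = Λ n × Λ n

-- The vector space of nested pairs

infixl 6 _⊞_
infix  8 ⊟_
infixr 7 _∙_

𝟘 : Λ n
𝟘 {zero}  = 0ℚ
𝟘 {suc n} = 𝟘 , 𝟘

_⊞_ : Λ n → Λ n → Λ n
_⊞_ {zero}  a       b         = a + b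
_⊞_ {suc n} (a , b) (a′ , b′) = a ⊞ a′ , b ⊞ b′

⊟_ : Λ n → Λ n
⊟_ {zero}  a       = - a
⊟_ {suc n} (a , b) = ⊟ a , ⊟ b

_∙_ : ℚ → Λ n → Λ n
_∙_ {zero}  c a       = c * a
_∙_ {suc n} c (a , b) = c ∙ a , c ∙ b

⊞-assoc : (a b c : Λ n) → (a ⊞ b) ⊞ c ≡ a ⊞ (b ⊞ c)
⊞-assoc {zero}  a b c = ℚ.+-assoc a b c
⊞-assoc {suc n} a b c = cong₂ _,_ (⊞-assoc _ _ _) (⊞-assoc _ _ _)

⊞-comm : (a b : Λ n) → a ⊞ b ≡ b ⊞ a
⊞-comm {zero}  a b = ℚ.+-comm a b
⊞-comm {suc n} a b = cong₂ _,_ (⊞-comm _ _) (⊞-comm _ _)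

⊞-identityˡ : (a : Λ n) → 𝟘 ⊞ a ≡ a
⊞-identityˡ {zero}  a = ℚ.+-identityˡ a
⊞-identityˡ {suc n} a = cong₂ _,_ (⊞-identityˡ _) (⊞-identityˡ _)

⊞-identityʳ : (a : Λ n) → a ⊞ 𝟘 ≡ a
⊞-identityʳ a = trans (⊞-comm a 𝟘) (⊞-identityˡ a)

⊞-inverseˡ : (a : Λ n) → ⊟ a ⊞ a ≡ 𝟘
⊞-inverseˡ {zero}  a = ℚ.+-inverseˡ a
⊞-inverseˡ {suc n} a = cong₂ _,_ (⊞-inverseˡ _) (⊞-inverseˡ _)

⊞-inverseʳ : (a : Λ n) → a ⊞ ⊟ a ≡ 𝟘
⊞-inverseʳ a = trans (⊞-comm a (⊟ a)) (⊞-inverseˡ a)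

∙-distrib-⊞ : ∀ c (a b : Λ n) → c ∙ (a ⊞ b) ≡ c ∙ a ⊞ c ∙ b
∙-distrib-⊞ {zero}  c a b = ℚ.*-distribˡ-+ c a b
∙-distrib-⊞ {suc n} c a b = cong₂ _,_ (∙-distrib-⊞ c _ _) (∙-distrib-⊞ c _ _)


∙-distrib-+ : ∀ c c′ (a : Λ n) → (c + c′) ∙ a ≡ c ∙ a ⊞ c′ ∙ a
∙-distrib-+ {zero}  c c′ a = ℚ.*-distribʳ-+ a c c′
∙-distrib-+ {suc n} c c′ a = cong₂ _,_ (∙-distrib-+ c c′ _) (∙-distrib-+ c c′ _)

∙-assoc : ∀ c c′ (a : Λ n) → (c * c′) ∙ a ≡ c ∙ c′ ∙ a
∙-assoc {zero}  c c′ a = ℚ.*-assoc c c′ a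
∙-assoc {suc n} c c′ a = cong₂ _,_ (∙-assoc c c′ _) (∙-assoc c c′ _)

∙-identity : (a : Λ n) → 1ℚ ∙ a ≡ a
∙-identity {zero}  a = ℚ.*-identityˡ a
∙-identity {suc n} a = cong₂ _,_ (∙-identity _) (∙-identity _)

∙-zeroˡ : (a : Λ n) → 0ℚ ∙ a ≡ 𝟘
∙-zeroˡ {zero}  a = ℚ.*-zeroˡ a
∙-zeroˡ {suc n} a = cong₂ _,_ (∙-zeroˡ _) (∙-zeroˡ _)

∙-zeroʳ : ∀ c → c ∙ 𝟘 {n} ≡ 𝟘
∙-zeroʳ {zero}  c = ℚ.*-zeroʳ c
∙-zeroʳ {suc n} c = cong₂ _,_ (∙-zeroʳ c) (∙-zeroʳ c)

⊟≡-1∙ : (a : Λ n) → ⊟ a ≡ (- 1ℚ) ∙ a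
⊟≡-1∙ {zero}  a = solve 1 (λ a → :- a := (:- con 1ℚ) :* a) refl a
⊟≡-1∙ {suc n} a = cong₂ _,_ (⊟≡-1∙ _) (⊟≡-1∙ _)

Λ-abelianGroup : ℕ → AbelianGroup _ _
Λ-abelianGroup n = record
  { Carrier = Λ n ; _≈_ = _≡_ ; _∙_ = _⊞_ ; ε = 𝟘 ; _⁻¹ = ⊟_
  ; isAbelianGroup = record
    { isGroup = record
      { isMonoid = record
        { isSemigroup = record
          { isMagma = record { isEquivalence = isEquivalence ; ∙-cong = cong₂ _⊞_ }
          ; assoc = ⊞-assoc }
        ; identity = ⊞-identityˡ , ⊞-identityʳ }
      ; inverse = ⊞-inverseˡ , ⊞-inverseʳ
      ; ⁻¹-cong = cong ⊟_ }
    ; comm = ⊞-comm } }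

module Λ-Group {n} = AbelianGroupProperties (Λ-abelianGroup n)
open Λ-Group using ()
  renaming (⁻¹-involutive to ⊟-involutive; ε⁻¹≈ε to ⊟-𝟘; ⁻¹-∙-comm to ⊟-⊞-comm;
            inverseˡ-unique to ⊟-uniqueˡ)

⊞-interchange : (a b c d : Λ n) → (a ⊞ b) ⊞ (c ⊞ d) ≡ (a ⊞ c) ⊞ (b ⊞ d)
⊞-interchange {zero}  = solve 4 (λ a b c d → (a :+ b) :+ (c :+ d) := (a :+ c) :+ (b :+ d)) refl
⊞-interchange {suc n} a b c d = cong₂ _,_ (⊞-interchange _ _ _ _) (⊞-interchange _ _ _ _)

⊞-⊟-cancel : (a b : Λ n) → (a ⊞ b) ⊞ ⊟ b ≡ a
⊞-⊟-cancel {zero}  = solve 2 (λ a b → (a :+ b) :+ :- b := a) refl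
⊞-⊟-cancel {suc n} a b = cong₂ _,_ (⊞-⊟-cancel _ _) (⊞-⊟-cancel _ _)

⊟-⊞-cancel : (a b : Λ n) → (a ⊞ ⊟ b) ⊞ b ≡ a
⊟-⊞-cancel {zero}  = solve 2 (λ a b → (a :+ :- b) :+ b := a) refl
⊟-⊞-cancel {suc n} a b = cong₂ _,_ (⊟-⊞-cancel _ _) (⊟-⊞-cancel _ _)

-- Linear maps

record Linear {m n} (f : Λ m → Λ n) : Set where
  field
    ⊞-homo : ∀ a b → f (a ⊞ b) ≡ f a ⊞ f b
    ∙-homo : ∀ c a → f (c ∙ a) ≡ c ∙ f a

  𝟘-homo : f 𝟘 ≡ 𝟘
  𝟘-homo = begin
    f 𝟘          ≡⟨ cong f (∙-zeroˡ 𝟘) ⟨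
    f (0ℚ ∙ 𝟘)   ≡⟨ ∙-homo 0ℚ 𝟘 ⟩
    0ℚ ∙ f 𝟘     ≡⟨ ∙-zeroˡ _ ⟩
    𝟘            ∎
    where open ≡-Reasoning

  ⊟-homo : ∀ a → f (⊟ a) ≡ ⊟ f a
  ⊟-homo a = begin
    f (⊟ a)          ≡⟨ cong f (⊟≡-1∙ a) ⟩
    f ((- 1ℚ) ∙ a)   ≡⟨ ∙-homo (- 1ℚ) a ⟩
    (- 1ℚ) ∙ f a     ≡⟨ ⊟≡-1∙ (f a) ⟨
    ⊟ f a            ∎
    where open ≡-Reasoning

open Linear

∙-comm : ∀ c c′ (a : Λ n) → c ∙ c′ ∙ a ≡ c′ ∙ c ∙ a
∙-comm c c′ a = begin
  c ∙ c′ ∙ a     ≡⟨ ∙-assoc c c′ a ⟨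
  (c * c′) ∙ a   ≡⟨ cong (_∙ a) (ℚ.*-comm c c′) ⟩
  (c′ * c) ∙ a   ≡⟨ ∙-assoc c′ c a ⟩
  c′ ∙ c ∙ a     ∎
  where open ≡-Reasoning

∙-linear : ∀ c → Linear {n} {n} (c ∙_)
∙-linear c = record { ⊞-homo = ∙-distrib-⊞ c ; ∙-homo = λ c′ a → ∙-comm c c′ a }

⊟-∙-comm : ∀ c (a : Λ n) → ⊟ (c ∙ a) ≡ c ∙ ⊟ a
⊟-∙-comm c a = sym (⊟-homo (∙-linear c) a)

⊟-linear : Linear {n} {n} ⊟_
⊟-linear = record { ⊞-homo = λ a b → sym (⊟-⊞-comm a b) ; ∙-homo = ⊟-∙-comm }

⊞-linear : ∀ {m n} {f g : Λ m → Λ n} → Linear f → Linear g → Linear (λ a → f a ⊞ g a)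
⊞-linear f g = record
  { ⊞-homo = λ a b → trans (cong₂ _⊞_ (⊞-homo f a b) (⊞-homo g a b)) (⊞-interchange _ _ _ _)
  ; ∙-homo = λ c a → trans (cong₂ _⊞_ (∙-homo f c a) (∙-homo g c a)) (sym (∙-distrib-⊞ c _ _)) }

∘-linear : ∀ {l m n} {f : Λ m → Λ n} {g : Λ l → Λ m} → Linear f → Linear g → Linear (λ a → f (g a))
∘-linear {f = f} lf lg = record
  { ⊞-homo = λ a b → trans (cong f (⊞-homo lg a b)) (⊞-homo lf _ _)
  ; ∙-homo = λ c a → trans (cong f (∙-homo lg c a)) (∙-homo lf c _) }

,-linear : ∀ {m n} {f g : Λ m → Λ n} → Linear f → Linear g → Linear {m} {suc n} (λ a → f a , g a)
,-linear f g = record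
  { ⊞-homo = λ a b → cong₂ _,_ (⊞-homo f a b) (⊞-homo g a b)
  ; ∙-homo = λ c a → cong₂ _,_ (∙-homo f c a) (∙-homo g c a) }

id-linear : Linear {n} {n} (λ a → a)
id-linear = record { ⊞-homo = λ _ _ → refl ; ∙-homo = λ _ _ → refl }

proj₁-linear : Linear {suc n} {n} proj₁
proj₁-linear = record { ⊞-homo = λ _ _ → refl ; ∙-homo = λ _ _ → refl }

proj₂-linear : Linear {suc n} {n} proj₂
proj₂-linear = record { ⊞-homo = λ _ _ → refl ; ∙-homo = λ _ _ → refl }

𝟘-linear : ∀ {m n} → Linear {m} {n} (λ _ → 𝟘)
𝟘-linear = record
  { ⊞-homo = λ _ _ → sym (⊞-identityˡ 𝟘) ; ∙-homo = λ c _ → sym (∙-zeroʳ c) }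

-- D and W are adjoint to the left multiplications by F 1 and F 2.
D : Λ n → Λ n
D {zero}  _       = 0ℚ
D {suc n} (a , b) = D a ⊞ b , ⊟ D b

W : Λ n → Λ n
W {zero}  _       = 0ℚ
W {suc n} (a , b) = W a ⊞ D b , W b

D-linear : Linear (D {n})
D-linear {zero}  = 𝟘-linear
D-linear {suc n} =
  ,-linear (⊞-linear (∘-linear D-linear proj₁-linear) proj₂-linear)
           (∘-linear ⊟-linear (∘-linear D-linear proj₂-linear))

W-linear : Linear (W {n})
W-linear {zero}  = 𝟘-linear
W-linear {suc n} =
  ,-linear (⊞-linear (∘-linear W-linear proj₁-linear) (∘-linear D-linear proj₂-linear))
           (∘-linear W-linear proj₂-linear)

D∘D≡𝟘 : (a : Λ n) → D (D a) ≡ 𝟘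
D∘D≡𝟘 {zero}  a       = refl
D∘D≡𝟘 {suc n} (a , b) = cong₂ _,_
  (begin
    D (D a ⊞ b) ⊞ ⊟ D b       ≡⟨ cong (_⊞ ⊟ D b) (⊞-homo D-linear _ _) ⟩
    (D (D a) ⊞ D b) ⊞ ⊟ D b   ≡⟨ ⊞-⊟-cancel _ _ ⟩
    D (D a)                   ≡⟨ D∘D≡𝟘 a ⟩
    𝟘                         ∎)
  (begin
    ⊟ D (⊟ D b)   ≡⟨ cong ⊟_ (⊟-homo D-linear _) ⟩
    ⊟ ⊟ D (D b)   ≡⟨ ⊟-involutive _ ⟩
    D (D b)       ≡⟨ D∘D≡𝟘 b ⟩
    𝟘             ∎)
  where open ≡-Reasoning

D∘W≡W∘D : (a : Λ n) → D (W a) ≡ W (D a)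
D∘W≡W∘D {zero}  a       = refl
D∘W≡W∘D {suc n} (a , b) = cong₂ _,_
  (begin
    D (W a ⊞ D b) ⊞ W b           ≡⟨ cong (_⊞ W b) (⊞-homo D-linear _ _) ⟩
    (D (W a) ⊞ D (D b)) ⊞ W b     ≡⟨ cong₂ (λ x y → (x ⊞ y) ⊞ W b) (D∘W≡W∘D a) (D∘D≡𝟘 b) ⟩
    (W (D a) ⊞ 𝟘) ⊞ W b           ≡⟨ cong (_⊞ W b) (⊞-identityʳ _) ⟩
    W (D a) ⊞ W b                 ≡⟨ ⊞-homo W-linear _ _ ⟨
    W (D a ⊞ b)                   ≡⟨ ⊞-identityʳ _ ⟨
    W (D a ⊞ b) ⊞ 𝟘               ≡⟨ cong (W (D a ⊞ b) ⊞_) D⊟Db≡𝟘 ⟨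
    W (D a ⊞ b) ⊞ D (⊟ D b)       ∎)
  (begin
    ⊟ D (W b)   ≡⟨ cong ⊟_ (D∘W≡W∘D b) ⟩
    ⊟ W (D b)   ≡⟨ ⊟-homo W-linear _ ⟨
    W (⊟ D b)   ∎)
  where
  open ≡-Reasoning
  D⊟Db≡𝟘 : D (⊟ D b) ≡ 𝟘
  D⊟Db≡𝟘 = trans (⊟-homo D-linear _) (trans (cong ⊟_ (D∘D≡𝟘 b)) ⊟-𝟘)

-- Powers of `W` after splitting off one or two variables

W^ : ℕ → Λ n → Λ n
W^ zero    a = a
W^ (suc r) a = W (W^ r a)

W^-linear : ∀ r → Linear (W^ {n} r)
W^-linear zero    = id-linear
W^-linear (suc r) = ∘-linear W-linear (W^-linear r)

D∘W^≡W^∘D : ∀ r (a : Λ n) → D (W^ r a) ≡ W^ r (D a)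
D∘W^≡W^∘D zero    a = refl
D∘W^≡W^∘D (suc r) a = trans (D∘W≡W∘D (W^ r a)) (cong W (D∘W^≡W^∘D r a))

fromℕ : ℕ → ℚ
fromℕ zero    = 0ℚ
fromℕ (suc r) = 1ℚ + fromℕ r

fromℕ-nonNegative : ∀ r → 0ℚ ℚ.≤ fromℕ r
fromℕ-nonNegative zero    = ℚ.≤-refl
fromℕ-nonNegative (suc r) = ℚ.+-mono-≤ (ℚ.nonNegative⁻¹ 1ℚ) (fromℕ-nonNegative r)

fromℕ-suc-inverse : ∀ r → ∃[ c ] fromℕ (suc r) * c ≡ 1ℚ
fromℕ-suc-inverse r = (ℚ.1/ fromℕ (suc r)) , ℚ.*-inverseʳ (fromℕ (suc r))
  where
  instance
    pos : ℚ.Positive (fromℕ (suc r))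
    pos = ℚ.positive (ℚ.+-mono-<-≤ (ℚ.positive⁻¹ 1ℚ) (fromℕ-nonNegative r))
    nonZero : ℚ.NonZero (fromℕ (suc r))
    nonZero = ℚ.pos⇒nonZero (fromℕ (suc r))

fromℕ-suc-cancel : ∀ r {a : Λ n} → fromℕ (suc r) ∙ a ≡ 𝟘 → a ≡ 𝟘
fromℕ-suc-cancel r {a} eq with c , ιc≡1 ← fromℕ-suc-inverse r = begin
  a                         ≡⟨ ∙-identity a ⟨
  1ℚ ∙ a                    ≡⟨ cong (_∙ a) ιc≡1 ⟨
  (fromℕ (suc r) * c) ∙ a   ≡⟨ ∙-assoc _ c a ⟩
  fromℕ (suc r) ∙ c ∙ a     ≡⟨ ∙-comm _ c a ⟩
  c ∙ fromℕ (suc r) ∙ a     ≡⟨ cong (c ∙_) eq ⟩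
  c ∙ 𝟘                     ≡⟨ ∙-zeroʳ c ⟩
  𝟘                         ∎
  where open ≡-Reasoning

-- On pairs `W` is block triangular with `W` twice on the diagonal and `D` off it. As `D` and `W`
-- commute, the off-diagonal block of the power collects `r + 1` equal terms.
W^-pair : ∀ r (a b : Λ n) → W^ (suc r) (a , b) ≡
  (W^ (suc r) a ⊞ fromℕ (suc r) ∙ W^ r (D b) , W^ (suc r) b)
W^-pair zero    a b = cong (λ x → W a ⊞ x , W b) (sym (∙-identity (D b)))
W^-pair (suc r) a b = trans (cong W (W^-pair r a b)) (cong (_, _) (begin
  W (W^ (suc r) a ⊞ ι ∙ W^ r (D b)) ⊞ D (W^ (suc r) b)
    ≡⟨ cong₂ _⊞_ (trans (⊞-homo W-linear _ _) (cong (_ ⊞_) (∙-homo W-linear ι _)))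
                 (D∘W^≡W^∘D (suc r) b) ⟩
  (W^ (suc (suc r)) a ⊞ ι ∙ w) ⊞ w
    ≡⟨ ⊞-assoc _ _ _ ⟩
  W^ (suc (suc r)) a ⊞ (ι ∙ w ⊞ w)
    ≡⟨ cong (_ ⊞_) (trans (⊞-comm _ w) (cong (_⊞ ι ∙ w) (sym (∙-identity w)))) ⟩
  W^ (suc (suc r)) a ⊞ (1ℚ ∙ w ⊞ ι ∙ w)
    ≡⟨ cong (_ ⊞_) (∙-distrib-+ 1ℚ ι w) ⟨
  W^ (suc (suc r)) a ⊞ fromℕ (suc (suc r)) ∙ w ∎))
  where
  open ≡-Reasoning
  ι = fromℕ (suc r)
  w = W^ (suc r) (D b)

-- The off-diagonal block contains `D b`. In `W^-quadruple` the second component is itself in the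
-- image of `D`, so this applies to the power `r`, including `r = 0`.
W^-pair-D≡𝟘 : ∀ r (a b : Λ n) → D b ≡ 𝟘 → W^ r (a , b) ≡ (W^ r a , W^ r b)
W^-pair-D≡𝟘 zero    a b Db≡𝟘 = refl
W^-pair-D≡𝟘 (suc r) a b Db≡𝟘 = trans (cong W (W^-pair-D≡𝟘 r a b Db≡𝟘)) (cong (_, _) (begin
  W^ (suc r) a ⊞ D (W^ r b)   ≡⟨ cong (_ ⊞_) (D∘W^≡W^∘D r b) ⟩
  W^ (suc r) a ⊞ W^ r (D b)   ≡⟨ cong (λ x → W^ (suc r) a ⊞ W^ r x) Db≡𝟘 ⟩
  W^ (suc r) a ⊞ W^ r 𝟘       ≡⟨ cong (W^ (suc r) a ⊞_) (𝟘-homo (W^-linear r)) ⟩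
  W^ (suc r) a ⊞ 𝟘            ≡⟨ ⊞-identityʳ _ ⟩
  W^ (suc r) a                ∎))
  where open ≡-Reasoning

-- By W^-pair, the off-diagonal part of W^(r+1) on one more variable is ιW^ r ∘ D.
ιW^ : ℕ → Λ n → Λ n
ιW^ r a = fromℕ (suc r) ∙ W^ r a

ιW^-linear : ∀ r → Linear (ιW^ {n} r)
ιW^-linear r = ∘-linear (∙-linear _) (W^-linear r)

-- The quadruple stands for `a + θ₂ c + θ₁ b + θ₁ θ₂ d`. The decisive term is `d` in the first
-- component: it comes from contracting θ₁ θ₂, carries no `D`, and ties `W^ (suc r) a` to `W^ r d`.
W^-quadruple : ∀ r (a c b d : Λ n) → W^ (suc r) ((a , c) , (b , d)) ≡
  ( (W^ (suc r) a ⊞ ιW^ r (D c ⊞ (D b ⊞ d)) , W^ (suc r) c ⊞ ιW^ r (⊟ D d))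
  , (W^ (suc r) b ⊞ ιW^ r (D d) , W^ (suc r) d) )
W^-quadruple r a c b d = trans (W^-pair r (a , c) (b , d)) (cong₂ _,_
  (begin
    W^ (suc r) (a , c) ⊞ fromℕ (suc r) ∙ W^ r (D b ⊞ d , ⊟ D d)
      ≡⟨ cong₂ (λ x y → x ⊞ fromℕ (suc r) ∙ y) (W^-pair r a c)
               (W^-pair-D≡𝟘 r _ _ (trans (⊟-homo D-linear _) (trans (cong ⊟_ (D∘D≡𝟘 d)) ⊟-𝟘))) ⟩
    (W^ (suc r) a ⊞ ιW^ r (D c)) ⊞ ιW^ r (D b ⊞ d) , W^ (suc r) c ⊞ ιW^ r (⊟ D d)
      ≡⟨ cong (_, _) (trans (⊞-assoc _ _ _) (cong (_ ⊞_) (sym (⊞-homo (ιW^-linear r) _ _)))) ⟩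
    W^ (suc r) a ⊞ ιW^ r (D c ⊞ (D b ⊞ d)) , W^ (suc r) c ⊞ ιW^ r (⊟ D d) ∎)
  (W^-pair r b d))
  where open ≡-Reasoning

-- Homogeneity of degree k - s, which may be negative.
H : ℕ → ℕ → Λ n → Set
H {zero}  s k a       = s ≢ k → a ≡ 0ℚ
H {suc n} s k (a , b) = H s k a × H (suc s) k b

H-𝟘 : ∀ s k → H {n} s k 𝟘
H-𝟘 {zero}  s k _ = refl
H-𝟘 {suc n} s k   = H-𝟘 s k , H-𝟘 (suc s) k

H-⊞ : ∀ {s k} {a b : Λ n} → H s k a → H s k b → H s k (a ⊞ b)
H-⊞ {zero}  h h′ s≢k = cong₂ _+_ (h s≢k) (h′ s≢k)
H-⊞ {suc n} (h₁ , h₂) (h₁′ , h₂′) = H-⊞ h₁ h₁′ , H-⊞ h₂ h₂′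

H-∙ : ∀ {s k} c {a : Λ n} → H s k a → H s k (c ∙ a)
H-∙ {zero}  c h s≢k = trans (cong (c *_) (h s≢k)) (ℚ.*-zeroʳ c)
H-∙ {suc n} c (h₁ , h₂) = H-∙ c h₁ , H-∙ c h₂

H-⊟ : ∀ {s k} {a : Λ n} → H s k a → H s k (⊟ a)
H-⊟ {s = s} {k} {a} h = subst (H s k) (sym (⊟≡-1∙ a)) (H-∙ (- 1ℚ) h)

H-D : ∀ {s k} {a : Λ n} → H s k a → H (suc s) k (D a)
H-D {zero}  h _ = refl
H-D {suc n} (h₁ , h₂) = H-⊞ (H-D h₁) h₂ , H-⊟ (H-D h₂)

H-W : ∀ {s k} {a : Λ n} → H s k a → H (suc (suc s)) k (W a)
H-W {zero}  h _ = refl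
H-W {suc n} (h₁ , h₂) = H-⊞ (H-W h₁) (H-D h₂) , H-W h₂

-- This is `s + 2r`, built up in the way `W^` raises the offset, so that `H-W^` involves no
-- arithmetic.
shift : ℕ → ℕ → ℕ
shift zero    s = s
shift (suc r) s = suc (suc (shift r s))

shift-suc : ∀ r s → shift r (suc s) ≡ suc (shift r s)
shift-suc zero    s = refl
shift-suc (suc r) s = cong (λ t → suc (suc t)) (shift-suc r s)

shift-suc-suc : ∀ r s → shift r (suc (suc s)) ≡ suc (suc (shift r s))
shift-suc-suc r s = trans (shift-suc r (suc s)) (cong suc (shift-suc r s))

H-W^ : ∀ r {s k} {a : Λ n} → H s k a → H (shift r s) k (W^ r a)
H-W^ zero    h = h
H-W^ (suc r) h = H-W (H-W^ r h)

H-belowRange : ∀ {s k} {a : Λ n} → k < s → H s k a → a ≡ 𝟘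
H-belowRange {zero}  k<s h = h (ℕ.>⇒≢ k<s)
H-belowRange {suc n} k<s (h₁ , h₂) =
  cong₂ _,_ (H-belowRange k<s h₁) (H-belowRange (ℕ.m<n⇒m<1+n k<s) h₂)

H-aboveRange : ∀ {s k} {a : Λ n} → n ℕ.+ s < k → H s k a → a ≡ 𝟘
H-aboveRange {zero}  s<k h = h (ℕ.<⇒≢ s<k)
H-aboveRange {suc n} {s} {k} n+s<k (h₁ , h₂) = cong₂ _,_
  (H-aboveRange (ℕ.<-trans (ℕ.n<1+n _) n+s<k) h₁)
  (H-aboveRange (subst (_< k) (sym (ℕ.+-suc n s)) n+s<k) h₂)

-- The Lefschetz property of W

+-2*-suc : ∀ n m → n ℕ.+ 2 ℕ.* suc m ≡ suc (suc n) ℕ.+ 2 ℕ.* m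
+-2*-suc = solve-∀

-- The pairs `(r + 2, s)`, `(r + 1, s + 1)` and `(r, s + 2)` belong to the components `a`, to `b`
-- and `c`, and to `d`. With two variables fewer they all give the same threshold as `(r + 1, s)`.
-- The predicate `Q` lets one computation serve both directions of the inequality.
module _ {n} (r s : ℕ) {Q : ℕ → Set}
  (h : Q (suc (suc n) ℕ.+ 2 ℕ.* (suc r ℕ.+ s))) where

  bound[r+2,s] : Q (n ℕ.+ 2 ℕ.* (suc (suc r) ℕ.+ s))
  bound[r+2,s] = subst Q (sym (+-2*-suc n (suc r ℕ.+ s))) h

  bound[r+1,s+1] : Q (n ℕ.+ 2 ℕ.* (suc r ℕ.+ suc s))
  bound[r+1,s+1] =
    subst (λ m → Q (n ℕ.+ 2 ℕ.* m)) (cong suc (sym (ℕ.+-suc r s))) bound[r+2,s]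

  bound[r,s+2] : Q (n ℕ.+ 2 ℕ.* (r ℕ.+ suc (suc s)))
  bound[r,s+2] =
    subst (λ m → Q (n ℕ.+ 2 ℕ.* m)) (sym (ℕ.+-suc r (suc s))) bound[r+1,s+1]

-- For at most one variable `W` is zero, so a positive power can be injective only on the zero
-- space: the bound pushes the source degree above `n`.
aboveRange-≤1 : ∀ {n k} r s → n ≤ 1 → n ℕ.+ 2 ℕ.* (suc r ℕ.+ s) ≤ 2 ℕ.* k → n ℕ.+ s < k
aboveRange-≤1 {n} {k} r s n≤1 h = ℕ.*-cancelˡ-< 2 _ _ (begin-strict
  2 ℕ.* (n ℕ.+ s)               ≡⟨ expand n s ⟩
  n ℕ.+ (n ℕ.+ 2 ℕ.* s)         <⟨ ℕ.+-monoʳ-< n (ℕ.+-monoˡ-< (2 ℕ.* s) (s≤s n≤1)) ⟩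
  n ℕ.+ (2 ℕ.+ 2 ℕ.* s)         ≡⟨ cong (n ℕ.+_) (ℕ.*-suc 2 s) ⟨
  n ℕ.+ 2 ℕ.* suc s             ≤⟨ ℕ.+-monoʳ-≤ n (ℕ.*-monoʳ-≤ 2 (s≤s (ℕ.m≤n+m s r))) ⟩
  n ℕ.+ 2 ℕ.* (suc r ℕ.+ s)     ≤⟨ h ⟩
  2 ℕ.* k                       ∎)
  where
  open ℕ.≤-Reasoning
  expand : ∀ n s → 2 ℕ.* (n ℕ.+ s) ≡ n ℕ.+ (n ℕ.+ 2 ℕ.* s)
  expand = solve-∀

+≤shift : ∀ r s → r ℕ.+ s ≤ shift r s
+≤shift zero    s = ℕ.≤-refl
+≤shift (suc r) s = s≤s (ℕ.m≤n⇒m≤1+n (+≤shift r s))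

-- The counterpart for surjectivity: where `W` is zero, the bound makes the target degree negative.
belowRange-≤1 : ∀ {n k} r s → n ≤ 1 → 2 ℕ.* k ≤ n ℕ.+ 2 ℕ.* (suc r ℕ.+ s) → k < shift (suc r) s
belowRange-≤1 {n} {k} r s n≤1 h =
  ℕ.<-≤-trans (ℕ.*-cancelˡ-< 2 _ _ (begin-strict
    2 ℕ.* k                     ≤⟨ h ⟩
    n ℕ.+ 2 ℕ.* (suc r ℕ.+ s)   <⟨ ℕ.+-monoˡ-< _ (s≤s n≤1) ⟩
    2 ℕ.+ 2 ℕ.* (suc r ℕ.+ s)   ≡⟨ ℕ.*-suc 2 (suc r ℕ.+ s) ⟨
    2 ℕ.* suc (suc r ℕ.+ s)     ∎))
  (s≤s (s≤s (+≤shift r s)))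
  where open ℕ.≤-Reasoning

⊞-⊟-shuffle : (a b c : Λ n) → (a ⊞ c) ⊞ (b ⊞ ⊟ c) ≡ a ⊞ b
⊞-⊟-shuffle {zero}  = solve 3 (λ a b c → (a :+ c) :+ (b :+ :- c) := a :+ b) refl
⊞-⊟-shuffle {suc n} a b c = cong₂ _,_ (⊞-⊟-shuffle _ _ _) (⊞-⊟-shuffle _ _ _)

-- The four component equations are coupled through `D`. They are decoupled by treating `c ⊞ b`
-- first, then `a`, `d`, `b` and `c`, each by the induction hypothesis for its own power, except
-- that `c` follows from the sum.
W^-injective : ∀ r s {n k} {v : Λ n} → n ℕ.+ 2 ℕ.* (r ℕ.+ s) ≤ 2 ℕ.* k →
  H s k v → W^ r v ≡ 𝟘 → v ≡ 𝟘
W^-injective zero    s bound h eq = eq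
W^-injective (suc r) s {zero}     bound h eq = H-aboveRange (aboveRange-≤1 r s z≤n bound) h
W^-injective (suc r) s {suc zero} bound h eq = H-aboveRange (aboveRange-≤1 r s (s≤s z≤n) bound) h
W^-injective (suc r) s {suc (suc n)} {k} {(a , c) , (b , d)} bound ((ha , hc) , (hb , hd)) eq =
  cong₂ _,_ (cong₂ _,_ a≡𝟘 c≡𝟘) (cong₂ _,_ b≡𝟘 d≡𝟘)
  where
  open ≡-Reasoning
  eq′ = trans (sym (W^-quadruple r a c b d)) eq
  eqa : W^ (suc r) a ⊞ ιW^ r (D c ⊞ (D b ⊞ d)) ≡ 𝟘
  eqa = cong (λ v → proj₁ (proj₁ v)) eq′
  eqc : W^ (suc r) c ⊞ ιW^ r (⊟ D d) ≡ 𝟘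
  eqc = cong (λ v → proj₂ (proj₁ v)) eq′
  eqb : W^ (suc r) b ⊞ ιW^ r (D d) ≡ 𝟘
  eqb = cong (λ v → proj₁ (proj₂ v)) eq′
  eqd : W^ (suc r) d ≡ 𝟘
  eqd = cong (λ v → proj₂ (proj₂ v)) eq′

  -- The terms in `D d` enter the equations for `b` and `c` with opposite signs and cancel in the
  -- sum.
  c⊞b≡𝟘 : c ⊞ b ≡ 𝟘
  c⊞b≡𝟘 = W^-injective (suc r) (suc s) (bound[r+1,s+1] r s {_≤ 2 ℕ.* k} bound) (H-⊞ hc hb) (begin
    W^ (suc r) (c ⊞ b)                  ≡⟨ ⊞-homo (W^-linear (suc r)) c b ⟩
    W^ (suc r) c ⊞ W^ (suc r) b         ≡⟨ ⊞-comm _ _ ⟩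
    W^ (suc r) b ⊞ W^ (suc r) c         ≡⟨ ⊞-⊟-shuffle _ _ x ⟨
    (W^ (suc r) b ⊞ x) ⊞ (W^ (suc r) c ⊞ ⊟ x)
      ≡⟨ cong (λ y → (W^ (suc r) b ⊞ x) ⊞ (W^ (suc r) c ⊞ y)) (⊟-homo (ιW^-linear r) (D d)) ⟨
    (W^ (suc r) b ⊞ x) ⊞ (W^ (suc r) c ⊞ ιW^ r (⊟ D d))
      ≡⟨ cong₂ _⊞_ eqb eqc ⟩
    𝟘 ⊞ 𝟘                               ≡⟨ ⊞-identityˡ 𝟘 ⟩
    𝟘                                   ∎)
    where x = ιW^ r (D d)

  -- Now `D c ⊞ D b` vanishes, so `d` is all that remains of the coupling.
  eqa′ : W^ (suc r) a ⊞ ιW^ r d ≡ 𝟘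
  eqa′ = trans (cong (λ x → W^ (suc r) a ⊞ ιW^ r x) (begin
    d                    ≡⟨ ⊞-identityˡ d ⟨
    𝟘 ⊞ d                ≡⟨ cong (_⊞ d) (𝟘-homo D-linear) ⟨
    D 𝟘 ⊞ d              ≡⟨ cong (λ x → D x ⊞ d) c⊞b≡𝟘 ⟨
    D (c ⊞ b) ⊞ d        ≡⟨ cong (_⊞ d) (⊞-homo D-linear c b) ⟩
    (D c ⊞ D b) ⊞ d      ≡⟨ ⊞-assoc _ _ _ ⟩
    D c ⊞ (D b ⊞ d)      ∎)) eqa

  -- One more `W` turns the term in `d` into a multiple of `W^ (suc r) d`, which is zero; this is
  -- why `a` needs the power `r + 2`.
  a≡𝟘 : a ≡ 𝟘
  a≡𝟘 = W^-injective (suc (suc r)) s (bound[r+2,s] r s {_≤ 2 ℕ.* k} bound) ha (begin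
    W^ (suc (suc r)) a                                ≡⟨ ⊞-identityʳ _ ⟨
    W^ (suc (suc r)) a ⊞ 𝟘                            ≡⟨ cong (W^ (suc (suc r)) a ⊞_) (∙-zeroʳ (fromℕ (suc r))) ⟨
    W^ (suc (suc r)) a ⊞ fromℕ (suc r) ∙ 𝟘            ≡⟨ cong (λ x → W^ (suc (suc r)) a ⊞ fromℕ (suc r) ∙ x) eqd ⟨
    W^ (suc (suc r)) a ⊞ fromℕ (suc r) ∙ W^ (suc r) d ≡⟨ cong (W^ (suc (suc r)) a ⊞_) (∙-homo W-linear _ _) ⟨
    W^ (suc (suc r)) a ⊞ W (ιW^ r d)                  ≡⟨ ⊞-homo W-linear _ _ ⟨
    W (W^ (suc r) a ⊞ ιW^ r d)                        ≡⟨ cong W eqa′ ⟩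
    W 𝟘                                               ≡⟨ 𝟘-homo W-linear ⟩
    𝟘                                                 ∎)

  W^𝟘⊞ : ∀ {x : Λ n} y → x ≡ 𝟘 → W^ (suc r) x ⊞ y ≡ 𝟘 → y ≡ 𝟘
  W^𝟘⊞ {x} y x≡𝟘 eq = begin
    y                   ≡⟨ ⊞-identityˡ y ⟨
    𝟘 ⊞ y               ≡⟨ cong (_⊞ y) (trans (cong (W^ (suc r)) x≡𝟘) (𝟘-homo (W^-linear (suc r)))) ⟨
    W^ (suc r) x ⊞ y    ≡⟨ eq ⟩
    𝟘                   ∎

  d≡𝟘 : d ≡ 𝟘
  d≡𝟘 = W^-injective r (suc (suc s)) (bound[r,s+2] r s {_≤ 2 ℕ.* k} bound) hd
    (fromℕ-suc-cancel r (W^𝟘⊞ _ a≡𝟘 eqa′))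

  b≡𝟘 : b ≡ 𝟘
  b≡𝟘 = W^-injective (suc r) (suc s) (bound[r+1,s+1] r s {_≤ 2 ℕ.* k} bound) hb (begin
    W^ (suc r) b               ≡⟨ ⊞-identityʳ _ ⟨
    W^ (suc r) b ⊞ 𝟘           ≡⟨ cong (W^ (suc r) b ⊞_) (𝟘-homo (∘-linear (ιW^-linear r) D-linear)) ⟨
    W^ (suc r) b ⊞ ιW^ r (D 𝟘) ≡⟨ cong (λ x → W^ (suc r) b ⊞ ιW^ r (D x)) d≡𝟘 ⟨
    W^ (suc r) b ⊞ ιW^ r (D d) ≡⟨ eqb ⟩
    𝟘                          ∎)

  c≡𝟘 : c ≡ 𝟘
  c≡𝟘 = begin
    c       ≡⟨ ⊞-identityʳ c ⟨
    c ⊞ 𝟘   ≡⟨ cong (c ⊞_) b≡𝟘 ⟨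
    c ⊞ b   ≡⟨ c⊞b≡𝟘 ⟩
    𝟘       ∎

fromℕ-suc-∙-inverse : ∀ r {c} → fromℕ (suc r) * c ≡ 1ℚ → (a : Λ n) → fromℕ (suc r) ∙ c ∙ a ≡ a
fromℕ-suc-∙-inverse r {c} eq a = begin
  fromℕ (suc r) ∙ c ∙ a     ≡⟨ ∙-assoc _ c a ⟨
  (fromℕ (suc r) * c) ∙ a   ≡⟨ cong (_∙ a) eq ⟩
  1ℚ ∙ a                    ≡⟨ ∙-identity a ⟩
  a                         ∎
  where open ≡-Reasoning

sub-sub : (a x y : Λ n) → a ⊞ ⊟ (a ⊞ ⊟ (x ⊞ y)) ≡ x ⊞ y
sub-sub {zero}  = solve 3 (λ a x y → a :+ :- (a :+ :- (x :+ y)) := x :+ y) refl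
sub-sub {suc n} a x y = cong₂ _,_ (sub-sub _ _ _) (sub-sub _ _ _)

⊞-sub : (a b : Λ n) → b ⊞ (a ⊞ ⊟ b) ≡ a
⊞-sub {zero}  = solve 2 (λ a b → b :+ (a :+ :- b) := a) refl
⊞-sub {suc n} a b = cong₂ _,_ (⊞-sub _ _) (⊞-sub _ _)

sub-add : (b c x : Λ n) → ((b ⊞ c) ⊞ ⊟ (b ⊞ ⊟ x)) ⊞ ⊟ x ≡ c
sub-add {zero}  = solve 3 (λ b c x → ((b :+ c) :+ :- (b :+ :- x)) :+ :- x := c) refl
sub-add {suc n} b c x = cong₂ _,_ (sub-add _ _ _) (sub-add _ _ _)

⊞-⊟-assoc : (e b d : Λ n) → (e ⊞ ⊟ b) ⊞ (b ⊞ d) ≡ e ⊞ d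
⊞-⊟-assoc {zero}  = solve 3 (λ e b d → (e :+ :- b) :+ (b :+ d) := e :+ d) refl
⊞-⊟-assoc {suc n} e b d = cong₂ _,_ (⊞-⊟-assoc _ _ _) (⊞-⊟-assoc _ _ _)

-- For v = ((a , c) , (b , d)) and r = r′ + 1, one first finds e = b + c, then a from the
-- equation obtained by one more application of W, which eliminates d; then d, and finally b.
W^-surjective : ∀ r s {n k} (u : Λ n) → 2 ℕ.* k ≤ n ℕ.+ 2 ℕ.* (r ℕ.+ s) →
  H (shift r s) k u → ∃[ v ] H s k v × W^ r v ≡ u
W^-surjective zero    s u bound h = u , h , refl
W^-surjective (suc r) s {zero} u bound h =
  𝟘 , H-𝟘 s _ , trans (𝟘-homo (W^-linear (suc r))) (sym (H-belowRange (belowRange-≤1 r s z≤n bound) h))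
W^-surjective (suc r) s {suc zero} u bound h =
  𝟘 , H-𝟘 {1} s _ , trans (𝟘-homo (W^-linear (suc r)))
    (sym (H-belowRange (belowRange-≤1 r s (s≤s z≤n) bound) h))
W^-surjective (suc r) s {suc (suc n)} {k} ((a′ , c′) , (b′ , d′)) bound ((ha′ , hc′) , (hb′ , hd′))
  with γ , ιγ≡1 ← fromℕ-suc-inverse r
  with e , he , eqe ← W^-surjective (suc r) (suc s) (b′ ⊞ c′) (bound[r+1,s+1] r s {2 ℕ.* k ≤_} bound)
         (subst (λ t → H t k (b′ ⊞ c′)) (sym (shift-suc (suc r) s)) (H-⊞ hb′ hc′))
  -- The target is what `W` applied to the first component equation leaves for `a`, with `d′` put
  -- for `W^ (suc r) d`.
  with a , ha , eqa ← W^-surjective (suc (suc r)) s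
         (W a′ ⊞ ⊟ (fromℕ (suc r) ∙ W^ (suc r) (D e) ⊞ fromℕ (suc r) ∙ d′))
         (bound[r+2,s] r s {2 ℕ.* k ≤_} bound)
         (H-⊞ (H-W ha′) (H-⊟ (H-⊞
           (H-∙ _ (subst (λ t → H t k (W^ (suc r) (D e))) (shift-suc-suc (suc r) s) (H-W^ (suc r) (H-D he))))
           (H-∙ _ hd′))))
  -- The first component equation solved for `W^ r d`, after division by `r + 1` by means of `γ`.
  with d , hd , eqd ← W^-surjective r (suc (suc s)) (γ ∙ (a′ ⊞ ⊟ W^ (suc r) a) ⊞ ⊟ W^ r (D e))
         (bound[r,s+2] r s {2 ℕ.* k ≤_} bound)
         (H-⊞ (H-∙ γ (H-⊞ (subst (λ t → H t k a′) (sym (shift-suc-suc r s)) ha′)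
                          (H-⊟ (subst (λ t → H t k (W^ (suc r) a)) (sym (shift-suc-suc r s))
                                      (H-W^ (suc r) ha)))))
              (H-⊟ (H-W^ r (H-D he))))
  with b , hb , eqb ← W^-surjective (suc r) (suc s) (b′ ⊞ ⊟ ιW^ r (D d)) (bound[r+1,s+1] r s {2 ℕ.* k ≤_} bound)
         (H-⊞ (subst (λ t → H t k b′) (sym (shift-suc (suc r) s)) hb′)
              (H-⊟ (H-∙ _ (subst (λ t → H t k (W^ r (D d))) (shift-suc-suc r (suc s)) (H-W^ r (H-D hd))))))
  = ((a , e ⊞ ⊟ b) , (b , d))
  , ((ha , H-⊞ he (H-⊟ hb)) , (hb , hd))
  , trans (W^-quadruple r a (e ⊞ ⊟ b) b d) (cong₂ _,_ (cong₂ _,_ eqa₁ eqc₁) (cong₂ _,_ eqb₁ eqd₁))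
  where
  ι : Λ n → Λ n
  ι = fromℕ (suc r) ∙_
  open ≡-Reasoning
  eqa₁ : W^ (suc r) a ⊞ ιW^ r (D (e ⊞ ⊟ b) ⊞ (D b ⊞ d)) ≡ a′
  eqa₁ = begin
    A ⊞ ιW^ r (D (e ⊞ ⊟ b) ⊞ (D b ⊞ d))
      ≡⟨ cong (λ x → A ⊞ ιW^ r (x ⊞ (D b ⊞ d)))
              (trans (⊞-homo D-linear e _) (cong (D e ⊞_) (⊟-homo D-linear b))) ⟩
    A ⊞ ιW^ r ((D e ⊞ ⊟ D b) ⊞ (D b ⊞ d))
      ≡⟨ cong (λ x → A ⊞ ιW^ r x) (⊞-⊟-assoc (D e) (D b) d) ⟩
    A ⊞ ι (W^ r (D e ⊞ d))
      ≡⟨ cong (λ x → A ⊞ ι x) (⊞-homo (W^-linear r) _ _) ⟩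
    A ⊞ ι (W^ r (D e) ⊞ W^ r d)
      ≡⟨ cong (λ x → A ⊞ ι (W^ r (D e) ⊞ x)) eqd ⟩
    A ⊞ ι (W^ r (D e) ⊞ (γ ∙ (a′ ⊞ ⊟ A) ⊞ ⊟ W^ r (D e)))
      ≡⟨ cong (λ x → A ⊞ ι x) (⊞-sub _ (W^ r (D e))) ⟩
    A ⊞ ι (γ ∙ (a′ ⊞ ⊟ A))
      ≡⟨ cong (A ⊞_) (fromℕ-suc-∙-inverse r ιγ≡1 _) ⟩
    A ⊞ (a′ ⊞ ⊟ A)
      ≡⟨ ⊞-sub a′ A ⟩
    a′ ∎
    where A = W^ (suc r) a
  eqb₁ : W^ (suc r) b ⊞ ιW^ r (D d) ≡ b′
  eqb₁ = trans (cong (_⊞ ιW^ r (D d)) eqb) (⊟-⊞-cancel b′ _)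
  eqc₁ : W^ (suc r) (e ⊞ ⊟ b) ⊞ ιW^ r (⊟ D d) ≡ c′
  eqc₁ = begin
    W^ (suc r) (e ⊞ ⊟ b) ⊞ ιW^ r (⊟ D d)
      ≡⟨ cong₂ _⊞_ (trans (⊞-homo (W^-linear (suc r)) e _)
                          (cong (W^ (suc r) e ⊞_) (⊟-homo (W^-linear (suc r)) b)))
                   (⊟-homo (ιW^-linear r) (D d)) ⟩
    (W^ (suc r) e ⊞ ⊟ W^ (suc r) b) ⊞ ⊟ ιW^ r (D d)
      ≡⟨ cong₂ (λ x y → (x ⊞ ⊟ y) ⊞ ⊟ ιW^ r (D d)) eqe eqb ⟩
    ((b′ ⊞ c′) ⊞ ⊟ (b′ ⊞ ⊟ ιW^ r (D d))) ⊞ ⊟ ιW^ r (D d)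
      ≡⟨ sub-add b′ c′ _ ⟩
    c′ ∎
  -- The vector `d` was chosen for the first equation only; the last one holds because of the choice
  -- of `a`.
  eqd₁ : W^ (suc r) d ≡ d′
  eqd₁ = begin
    W (W^ r d)
      ≡⟨ cong W eqd ⟩
    W (γ ∙ (a′ ⊞ ⊟ W^ (suc r) a) ⊞ ⊟ W^ r (D e))
      ≡⟨ trans (⊞-homo W-linear _ _) (cong₂ _⊞_ (∙-homo W-linear γ _) (⊟-homo W-linear _)) ⟩
    γ ∙ W (a′ ⊞ ⊟ W^ (suc r) a) ⊞ ⊟ x
      ≡⟨ cong (λ y → γ ∙ y ⊞ ⊟ x) (trans (⊞-homo W-linear _ _) (cong (W a′ ⊞_) (⊟-homo W-linear _))) ⟩
    γ ∙ (W a′ ⊞ ⊟ W^ (suc (suc r)) a) ⊞ ⊟ x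
      ≡⟨ cong (λ y → γ ∙ (W a′ ⊞ ⊟ y) ⊞ ⊟ x) eqa ⟩
    γ ∙ (W a′ ⊞ ⊟ (W a′ ⊞ ⊟ (ι x ⊞ ι d′))) ⊞ ⊟ x
      ≡⟨ cong (λ y → γ ∙ y ⊞ ⊟ x) (sub-sub (W a′) (ι x) (ι d′)) ⟩
    γ ∙ (ι x ⊞ ι d′) ⊞ ⊟ x
      ≡⟨ cong (λ y → γ ∙ y ⊞ ⊟ x) (∙-distrib-⊞ _ x d′) ⟨
    γ ∙ ι (x ⊞ d′) ⊞ ⊟ x
      ≡⟨ cong (_⊞ ⊟ x) (trans (∙-comm γ _ _) (fromℕ-suc-∙-inverse r ιγ≡1 _)) ⟩
    (x ⊞ d′) ⊞ ⊟ x
      ≡⟨ cong (_⊞ ⊟ x) (⊞-comm x d′) ⟩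
    (d′ ⊞ x) ⊞ ⊟ x
      ≡⟨ ⊞-⊟-cancel d′ x ⟩
    d′ ∎
    where x = W^ (suc r) (D e)

-- Dimensions of the harmonic spaces

-- Built from the smallest entry on: each constructor puts the next entry at the end of a row.
data Ballot : ℕ → ℕ → Set where
  []     : Ballot 0 0
  top    : ∀ {a b} → Ballot a b → Ballot (suc a) b
  bottom : ∀ {a b} → suc b ≤ a → Ballot a b → Ballot a (suc b)

-- The clauses run parallel to `dim-Harmonic`: sequences ending in `top` account for the kernel of
-- the projection to the θ₁-component, those ending in `bottom` for its image.
ballots : ∀ a b → List (Ballot a b)
ballots zero    zero    = [] ∷ []
ballots zero    (suc b) = []
ballots (suc a) zero    = List.map top (ballots a 0)
ballots (suc a) (suc b) with suc b ℕ.≤? suc a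
... | yes b<a = List.map top (ballots a (suc b)) List.++ List.map (bottom b<a) (ballots (suc a) b)
... | no  _   = []

Harmonic : ℕ → ℕ → Λ n → Set
Harmonic s k v = D v ≡ 𝟘 × W v ≡ 𝟘 × H s k v

Harmonic-𝟘 : ∀ s k → Harmonic {n} s k 𝟘
Harmonic-𝟘 s k = 𝟘-homo D-linear , 𝟘-homo W-linear , H-𝟘 s k

Harmonic-⊞ : ∀ {s k} {v w : Λ n} → Harmonic s k v → Harmonic s k w → Harmonic s k (v ⊞ w)
Harmonic-⊞ (Dv , Wv , hv) (Dw , Ww , hw) =
  trans (⊞-homo D-linear _ _) (trans (cong₂ _⊞_ Dv Dw) (⊞-identityˡ 𝟘)) ,
  trans (⊞-homo W-linear _ _) (trans (cong₂ _⊞_ Wv Ww) (⊞-identityˡ 𝟘)) ,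
  H-⊞ hv hw

Harmonic-∙ : ∀ {s k} c {v : Λ n} → Harmonic s k v → Harmonic s k (c ∙ v)
Harmonic-∙ c (Dv , Wv , hv) =
  trans (∙-homo D-linear c _) (trans (cong (c ∙_) Dv) (∙-zeroʳ c)) ,
  trans (∙-homo W-linear c _) (trans (cong (c ∙_) Wv) (∙-zeroʳ c)) ,
  H-∙ c hv

Harmonic-⊟ : ∀ {s k} {v : Λ n} → Harmonic s k v → Harmonic s k (⊟ v)
Harmonic-⊟ {s = s} {k} {v} hv = subst (Harmonic s k) (sym (⊟≡-1∙ v)) (Harmonic-∙ (- 1ℚ) hv)

lc : ∀ {d} → Vec ℚ d → Vec (Λ n) d → Λ n
lc []       []       = 𝟘
lc (c ∷ cs) (v ∷ vs) = c ∙ v ⊞ lc cs vs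

lc-++ : ∀ {d e} (cs : Vec ℚ d) (ds : Vec ℚ e) (vs : Vec (Λ n) d) (ws : Vec (Λ n) e) →
  lc (cs ++ ds) (vs ++ ws) ≡ lc cs vs ⊞ lc ds ws
lc-++ []       ds []       ws = sym (⊞-identityˡ _)
lc-++ (c ∷ cs) ds (v ∷ vs) ws =
  trans (cong (c ∙ v ⊞_) (lc-++ cs ds vs ws)) (sym (⊞-assoc _ _ _))

lc-map : ∀ {m d} {f : Λ m → Λ n} → Linear f → (cs : Vec ℚ d) (vs : Vec (Λ m) d) →
  lc cs (map f vs) ≡ f (lc cs vs)
lc-map         f []       []       = sym (𝟘-homo f)
lc-map {f = g} f (c ∷ cs) (v ∷ vs) = begin
  c ∙ g v ⊞ lc cs (map g vs)   ≡⟨ cong₂ _⊞_ (sym (∙-homo f c v)) (lc-map f cs vs) ⟩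
  g (c ∙ v) ⊞ g (lc cs vs)     ≡⟨ ⊞-homo f _ _ ⟨
  g (c ∙ v ⊞ lc cs vs)         ∎
  where open ≡-Reasoning

lc-replicate-0 : ∀ {d} (vs : Vec (Λ n) d) → lc (replicate d 0ℚ) vs ≡ 𝟘
lc-replicate-0 []       = refl
lc-replicate-0 (v ∷ vs) =
  trans (cong₂ _⊞_ (∙-zeroˡ v) (lc-replicate-0 vs)) (⊞-identityˡ 𝟘)

Harmonic-lc : ∀ {s k d} (cs : Vec ℚ d) {vs : Vec (Λ n) d} →
  All (Harmonic s k) vs → Harmonic s k (lc cs vs)
Harmonic-lc []       []         = Harmonic-𝟘 _ _
Harmonic-lc (c ∷ cs) (hv ∷ hvs) = Harmonic-⊞ (Harmonic-∙ c hv) (Harmonic-lc cs hvs)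

record Dim (V : Λ n → Set) (d : ℕ) : Set where
  field
    basis       : Vec (Λ n) d
    basis∈V     : All V basis
    independent : ∀ cs → lc cs basis ≡ 𝟘 → cs ≡ replicate d 0ℚ
    spanning    : ∀ v → V v → ∃[ cs ] v ≡ lc cs basis

Dim-zero : {V : Λ n → Set} → (∀ v → V v → v ≡ 𝟘) → Dim V 0
Dim-zero V⊆𝟘 = record
  { basis = [] ; basis∈V = [] ; independent = λ { [] _ → refl }
  ; spanning = λ v v∈V → [] , V⊆𝟘 v v∈V }

-- As `v₁` is `⊟ D v₀`, it is killed by `D` because `D` squares to zero, and by `W` because `W`
-- commutes with `D`; the remaining component equations follow.
Harmonic-∷ : ∀ {s k} {v₀ v₁ : Λ n} → D v₀ ⊞ v₁ ≡ 𝟘 → W v₀ ≡ 𝟘 →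
  H s k v₀ → H (suc s) k v₁ → Harmonic {suc n} s k (v₀ , v₁)
Harmonic-∷ {v₀ = v₀} {v₁} Dv₀⊞v₁≡𝟘 Wv₀≡𝟘 h₀ h₁ =
  cong₂ _,_ Dv₀⊞v₁≡𝟘 (trans (cong ⊟_ Dv₁≡𝟘) ⊟-𝟘) ,
  cong₂ _,_ (trans (cong₂ _⊞_ Wv₀≡𝟘 Dv₁≡𝟘) (⊞-identityˡ 𝟘)) Wv₁≡𝟘 ,
  h₀ , h₁
  where
  open ≡-Reasoning
  vanish : ∀ {f : Λ _ → Λ _} → Linear f → f (D v₀) ≡ 𝟘 → f v₁ ≡ 𝟘
  vanish {f} lf fDv₀≡𝟘 = begin
    f v₁               ≡⟨ ⊞-identityˡ _ ⟨
    𝟘 ⊞ f v₁           ≡⟨ cong (_⊞ f v₁) fDv₀≡𝟘 ⟨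
    f (D v₀) ⊞ f v₁    ≡⟨ ⊞-homo lf _ _ ⟨
    f (D v₀ ⊞ v₁)      ≡⟨ cong f Dv₀⊞v₁≡𝟘 ⟩
    f 𝟘                ≡⟨ 𝟘-homo lf ⟩
    𝟘                  ∎
  Dv₁≡𝟘 : D v₁ ≡ 𝟘
  Dv₁≡𝟘 = vanish D-linear (D∘D≡𝟘 v₀)
  Wv₁≡𝟘 : W v₁ ≡ 𝟘
  Wv₁≡𝟘 = vanish W-linear
    (trans (sym (D∘W≡W∘D v₀)) (trans (cong D Wv₀≡𝟘) (𝟘-homo D-linear)))

module _ {s k} {v₀ v₁ : Λ n} (harm : Harmonic {suc n} s k (v₀ , v₁)) where

  Harmonic⇒D₀ : D v₀ ⊞ v₁ ≡ 𝟘
  Harmonic⇒D₀ = cong proj₁ (proj₁ harm)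

  Harmonic⇒D₁ : D v₁ ≡ 𝟘
  Harmonic⇒D₁ = trans (sym (⊟-involutive _)) (trans (cong ⊟_ (cong proj₂ (proj₁ harm))) ⊟-𝟘)

  Harmonic⇒W₀ : W v₀ ≡ 𝟘
  Harmonic⇒W₀ = begin
    W v₀          ≡⟨ ⊞-identityʳ _ ⟨
    W v₀ ⊞ 𝟘      ≡⟨ cong (W v₀ ⊞_) Harmonic⇒D₁ ⟨
    W v₀ ⊞ D v₁   ≡⟨ cong proj₁ (proj₁ (proj₂ harm)) ⟩
    𝟘             ∎
    where open ≡-Reasoning

  Harmonic-proj₂ : Harmonic (suc s) k v₁
  Harmonic-proj₂ = Harmonic⇒D₁ , cong proj₂ (proj₁ (proj₂ harm)) , proj₂ (proj₂ (proj₂ harm))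

-- What is sought is `p` with `D p ≡ ⊟ b` and `W p ≡ 𝟘`. Splitting a further variable off `p` and
-- `b` reduces both conditions to one equation for `W p₀` in `m` variables, where the given bound is
-- that of `W^-surjective` for the first power.
Harmonic-lift : ∀ {s k} {b : Λ n} → 2 ℕ.* k ≤ suc n ℕ.+ 2 ℕ.* s → Harmonic (suc s) k b →
  ∃[ v ] Harmonic {suc n} s k v × proj₂ v ≡ b
Harmonic-lift {zero} {s} {k} bound (_ , _ , h) =
  -- Without variables the bound forces `k ≤ s`, so `b` has negative degree and is zero.
  𝟘 , Harmonic-𝟘 s k , sym (H-belowRange (ℕ.*-cancelˡ-< 2 _ _
    (ℕ.≤-<-trans bound (ℕ.≤-reflexive (sym (ℕ.*-suc 2 s))))) h)
Harmonic-lift {suc m} {s} {k} {q₀ , q₁} bound harm@(_ , _ , hq)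
  -- The first component of `W p ≡ 𝟘` reads `W p₀ ⊞ D p₁ ≡ 𝟘`, and `D p₁` will be `q₁`.
  with p₀ , hp₀ , eq ← W^-surjective 1 s (⊟ q₁)
         (subst (2 ℕ.* k ≤_) (sym (+-2*-suc m s)) bound) (H-⊟ (proj₂ hq))
  = ((p₀ , p₁) , (q₀ , q₁))
  , Harmonic-∷ {v₀ = p₀ , p₁} {v₁ = q₀ , q₁}
      (cong₂ _,_ (⊞-sub₂ (D p₀) q₀) (trans (cong (λ x → ⊟ x ⊞ q₁) Dp₁≡q₁) (⊞-inverseˡ q₁)))
      (cong₂ _,_ (trans (cong₂ _⊞_ eq Dp₁≡q₁) (⊞-inverseˡ q₁)) Wp₁≡𝟘)
      (hp₀ , H-⊞ (H-⊟ (proj₁ hq)) (H-⊟ (H-D hp₀)))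
      hq
  , refl
  where
  open ≡-Reasoning
  -- Forced by the first component of `D p ≡ ⊟ q`.
  p₁ = ⊟ q₀ ⊞ ⊟ D p₀
  ⊞-sub₂ : ∀ {n} (a b : Λ n) → (a ⊞ (⊟ b ⊞ ⊟ a)) ⊞ b ≡ 𝟘
  ⊞-sub₂ {zero}  = solve 2 (λ a b → (a :+ (:- b :+ :- a)) :+ b := con 0ℚ) refl
  ⊞-sub₂ {suc n} a b = cong₂ _,_ (⊞-sub₂ _ _) (⊞-sub₂ _ _)
  f[p₁] : ∀ {f : Λ m → Λ m} → Linear f → f p₁ ≡ ⊟ f q₀ ⊞ ⊟ f (D p₀)
  f[p₁] lf = trans (⊞-homo lf _ _) (cong₂ _⊞_ (⊟-homo lf _) (⊟-homo lf _))
  Dp₁≡q₁ : D p₁ ≡ q₁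
  Dp₁≡q₁ = begin
    D p₁                    ≡⟨ f[p₁] D-linear ⟩
    ⊟ D q₀ ⊞ ⊟ D (D p₀)     ≡⟨ cong (λ x → ⊟ D q₀ ⊞ ⊟ x) (D∘D≡𝟘 p₀) ⟩
    ⊟ D q₀ ⊞ ⊟ 𝟘            ≡⟨ trans (cong (⊟ D q₀ ⊞_) ⊟-𝟘) (⊞-identityʳ _) ⟩
    ⊟ D q₀                  ≡⟨ Λ-Group.inverseʳ-unique _ _ (Harmonic⇒D₀ {s = suc s} {k} harm) ⟨
    q₁                      ∎
  Wp₁≡𝟘 : W p₁ ≡ 𝟘
  Wp₁≡𝟘 = begin
    W p₁                    ≡⟨ f[p₁] W-linear ⟩
    ⊟ W q₀ ⊞ ⊟ W (D p₀)     ≡⟨ cong₂ (λ x y → ⊟ x ⊞ ⊟ y) (Harmonic⇒W₀ {s = suc s} {k} harm) (sym (D∘W≡W∘D p₀)) ⟩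
    ⊟ 𝟘 ⊞ ⊟ D (W p₀)        ≡⟨ cong (λ x → ⊟ 𝟘 ⊞ ⊟ D x) eq ⟩
    ⊟ 𝟘 ⊞ ⊟ D (⊟ q₁)        ≡⟨ cong (λ x → ⊟ 𝟘 ⊞ ⊟ x) (⊟-homo D-linear q₁) ⟩
    ⊟ 𝟘 ⊞ ⊟ ⊟ D q₁          ≡⟨ cong₂ (λ x y → x ⊞ ⊟ ⊟ y) ⊟-𝟘 (Harmonic⇒D₁ {s = suc s} {k} harm) ⟩
    𝟘 ⊞ ⊟ ⊟ 𝟘               ≡⟨ trans (⊞-identityˡ _) (⊟-involutive 𝟘) ⟩
    𝟘                       ∎

-- The strict bound in `m + 1` variables is exactly the bound under which `W` is injective in `m`
-- variables. This gives `v₀ ≡ 𝟘`, and `v₁` is determined by `v₀`.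
Harmonic-vanish : ∀ {s k} {v : Λ n} → n ℕ.+ 2 ℕ.* s < 2 ℕ.* k → Harmonic s k v → v ≡ 𝟘
Harmonic-vanish {zero}  bound (_ , _ , h) = H-aboveRange (ℕ.*-cancelˡ-< 2 _ _ bound) h
Harmonic-vanish {suc m} {s} {k} {v₀ , v₁} bound harm@(_ , _ , h) = cong₂ _,_ v₀≡𝟘 (begin
  v₁           ≡⟨ ⊞-identityˡ v₁ ⟨
  𝟘 ⊞ v₁       ≡⟨ cong (_⊞ v₁) (trans (cong D v₀≡𝟘) (𝟘-homo D-linear)) ⟨
  D v₀ ⊞ v₁    ≡⟨ Harmonic⇒D₀ {s = s} {k} harm ⟩
  𝟘            ∎)
  where
  open ≡-Reasoning
  v₀≡𝟘 : v₀ ≡ 𝟘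
  v₀≡𝟘 = W^-injective 1 s (subst (_≤ 2 ℕ.* k) (sym (+-2*-suc m s)) bound)
    (proj₁ h) (Harmonic⇒W₀ {s = s} {k} harm)

unmap : ∀ {A B : Set} {f : A → B} {P : A → Set} {Q : B → Set} {d} →
  (∀ {y} → Q y → ∃[ x ] P x × f x ≡ y) → {ys : Vec B d} → All Q ys →
  ∃[ xs ] All P xs × map f xs ≡ ys
unmap lift [] = [] , [] , refl
unmap lift (qy ∷ qys)
  with x , px , fx≡y ← lift qy | xs , pxs , eq ← unmap lift qys
  = x ∷ xs , px ∷ pxs , cong₂ _∷_ fx≡y eq

-- The projection to the θ₁-component maps Harmonic s k onto Harmonic (suc s) k, with
-- kernel the Harmonic s k in the remaining variables.
Dim-Harmonic-suc : ∀ {s k d e} → 2 ℕ.* k ≤ suc n ℕ.+ 2 ℕ.* s →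
  Dim (Harmonic {n} s k) d → Dim (Harmonic {n} (suc s) k) e → Dim (Harmonic {suc n} s k) (d ℕ.+ e)
Dim-Harmonic-suc {n} {s} {k} {d} {e} bound dim₀ dim₁
  with ws , hws , proj₂ws≡ ← unmap {f = proj₂} {P = Harmonic {suc n} s k}
         (Harmonic-lift bound) (Dim.basis∈V dim₁)
  = record
  { basis       = map inj vs ++ ws
  ; basis∈V     = All.++⁺ (All.map⁺ (All.map inj-harmonic (Dim.basis∈V dim₀))) hws
  ; independent = indep
  ; spanning    = span }
  where
  open ≡-Reasoning
  vs = Dim.basis dim₀
  inj : Λ n → Λ (suc n)
  inj v = v , 𝟘
  inj-linear : Linear inj
  inj-linear = ,-linear id-linear 𝟘-linear
  inj-harmonic : ∀ {v} → Harmonic s k v → Harmonic {suc n} s k (inj v)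
  inj-harmonic (Dv , Wv , h) =
    Harmonic-∷ (trans (⊞-identityʳ _) Dv) Wv h (H-𝟘 (suc s) k)
  proj₂-lc : ∀ cs → proj₂ (lc cs ws) ≡ lc cs (Dim.basis dim₁)
  proj₂-lc cs = trans (sym (lc-map proj₂-linear cs ws)) (cong (lc cs) proj₂ws≡)
  lc-basis : ∀ cs ds → lc (cs ++ ds) (map inj vs ++ ws) ≡ inj (lc cs vs) ⊞ lc ds ws
  lc-basis cs ds = trans (lc-++ cs ds (map inj vs) ws) (cong (_⊞ lc ds ws) (lc-map inj-linear cs vs))
  replicate-++ : ∀ d e → replicate d 0ℚ ++ replicate e 0ℚ ≡ replicate (d ℕ.+ e) 0ℚ
  replicate-++ zero    e = refl
  replicate-++ (suc d) e = cong (0ℚ ∷_) (replicate-++ d e)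
  indep : ∀ cs → lc cs (map inj vs ++ ws) ≡ 𝟘 → cs ≡ replicate (d ℕ.+ e) 0ℚ
  indep cs′ eq with cs , ds , refl ← Vec.splitAt d cs′ =
    trans (cong₂ _++_ cs≡0 ds≡0) (replicate-++ d e)
    where
    eq′ : inj (lc cs vs) ⊞ lc ds ws ≡ 𝟘
    eq′ = trans (sym (lc-basis cs ds)) eq
    ds≡0 : ds ≡ replicate e 0ℚ
    ds≡0 = Dim.independent dim₁ ds (begin
      lc ds (Dim.basis dim₁)     ≡⟨ proj₂-lc ds ⟨
      proj₂ (lc ds ws)           ≡⟨ ⊞-identityˡ _ ⟨
      𝟘 ⊞ proj₂ (lc ds ws)       ≡⟨ cong proj₂ eq′ ⟩
      𝟘                          ∎)
    cs≡0 : cs ≡ replicate d 0ℚ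
    cs≡0 = Dim.independent dim₀ cs (begin
      lc cs vs                        ≡⟨ ⊞-identityʳ _ ⟨
      lc cs vs ⊞ 𝟘                    ≡⟨ cong (λ x → lc cs vs ⊞ proj₁ x) 
        (trans (cong (λ x → lc x ws) ds≡0) (lc-replicate-0 ws)) ⟨
      lc cs vs ⊞ proj₁ (lc ds ws)     ≡⟨ cong proj₁ eq′ ⟩
      𝟘                               ∎)
  proj₂≡𝟘 : ∀ v ds → proj₂ v ≡ lc ds (Dim.basis dim₁) → proj₂ v ⊞ ⊟ proj₂ (lc ds ws) ≡ 𝟘
  proj₂≡𝟘 v ds v₁≡ = trans (cong (λ x → proj₂ v ⊞ ⊟ x) (trans (proj₂-lc ds) (sym v₁≡))) (⊞-inverseʳ _)
  -- After subtraction of the lifted combination the θ₁-component is zero, so the equation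
  -- `D v₀ ⊞ v₁ ≡ 𝟘` becomes harmonicity in the remaining variables.
  kernel : ∀ v ds → proj₂ v ≡ lc ds (Dim.basis dim₁) → Harmonic {suc n} s k (v ⊞ ⊟ lc ds ws) →
    Harmonic {n} s k (proj₁ (v ⊞ ⊟ lc ds ws))
  kernel v ds v₁≡ harm@(_ , _ , h) =
    trans (sym (⊞-identityʳ _))
          (trans (cong (D (proj₁ (v ⊞ ⊟ lc ds ws)) ⊞_) (sym (proj₂≡𝟘 v ds v₁≡)))
                 (Harmonic⇒D₀ {s = s} {k} harm)) ,
    Harmonic⇒W₀ {s = s} {k} harm , proj₁ h
  span : ∀ v → Harmonic s k v → ∃[ cs ] v ≡ lc cs (map inj vs ++ ws)
  span v hv
    with ds , v₁≡ ← Dim.spanning dim₁ (proj₂ v) (Harmonic-proj₂ {s = s} {k} hv)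
    with cs , u≡ ← Dim.spanning dim₀ (proj₁ (v ⊞ ⊟ lc ds ws))
           (kernel v ds v₁≡ (Harmonic-⊞ {s = s} {k} hv (Harmonic-⊟ (Harmonic-lc ds hws))))
    = cs ++ ds , (begin
    v                                             ≡⟨ ⊟-⊞-cancel v (lc ds ws) ⟨
    (v ⊞ ⊟ lc ds ws) ⊞ lc ds ws                   ≡⟨ cong (_⊞ lc ds ws) (cong₂ _,_ u≡ (proj₂≡𝟘 v ds v₁≡)) ⟩
    inj (lc cs vs) ⊞ lc ds ws                     ≡⟨ lc-basis cs ds ⟨
    lc (cs ++ ds) (map inj vs ++ ws)              ∎)

-- Here `b` is the degree and `a` the codegree, so `b > a` is the range above the middle, where both
-- sides are zero. The offset is arbitrary because, with `k` fixed, passing to the θ₁-component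
-- trades a unit of `b` for a unit of `s`.
dim-Harmonic : ∀ n a b s → n ≡ a ℕ.+ b → Dim (Harmonic {n} s (s ℕ.+ b)) (List.length (ballots a b))
dim-Harmonic zero zero zero s refl = record
  { basis       = 1ℚ ∷ []
  ; basis∈V     = (refl , refl , λ s≢s+0 → contradiction (sym (ℕ.+-identityʳ s)) s≢s+0) ∷ []
  ; independent = λ { (c ∷ []) eq → cong (_∷ []) (trans (sym (lemma c)) eq) }
  ; spanning    = λ v _ → (v ∷ []) , sym (lemma v) }
  where
  lemma : ∀ c → c * 1ℚ + 0ℚ ≡ c
  lemma = solve 1 (λ c → c :* con 1ℚ :+ con 0ℚ := c) refl
dim-Harmonic (suc n) zero (suc b) s refl = Dim-zero λ v → Harmonic-vanish (begin-strict
  suc b ℕ.+ 2 ℕ.* s            <⟨ ℕ.+-monoˡ-< (2 ℕ.* s) (ℕ.m<m*n (suc b) 2 (s≤s (s≤s z≤n))) ⟩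
  suc b ℕ.* 2 ℕ.+ 2 ℕ.* s      ≡⟨ expand s (suc b) ⟩
  2 ℕ.* (s ℕ.+ suc b)          ∎)
  where
  open ℕ.≤-Reasoning
  expand : ∀ s b → b ℕ.* 2 ℕ.+ 2 ℕ.* s ≡ 2 ℕ.* (s ℕ.+ b)
  expand = solve-∀
dim-Harmonic (suc n) (suc a) zero s eq =
  subst (Dim _) (trans (ℕ.+-identityʳ _) (sym (List.length-map top (ballots a 0))))
    (Dim-Harmonic-suc (ℕ.≤-trans (ℕ.*-monoʳ-≤ 2 (ℕ.≤-reflexive (ℕ.+-identityʳ s))) (ℕ.m≤n+m _ (suc n)))
      (dim-Harmonic n a 0 s (ℕ.suc-injective eq))
      -- In degree 0 the θ₁-component would have degree -1.
      (Dim-zero λ v (_ , _ , h) → H-belowRange (s≤s (ℕ.≤-reflexive (ℕ.+-identityʳ s))) h))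
dim-Harmonic (suc n) (suc a) (suc b) s eq with suc b ℕ.≤? suc a
... | no b≰a = Dim-zero λ v → Harmonic-vanish (begin-strict
  suc n ℕ.+ 2 ℕ.* s                ≡⟨ cong (ℕ._+ 2 ℕ.* s) eq ⟩
  suc a ℕ.+ suc b ℕ.+ 2 ℕ.* s      <⟨ ℕ.+-monoˡ-< (2 ℕ.* s) (ℕ.+-monoˡ-< (suc b) (ℕ.≰⇒> b≰a)) ⟩
  suc b ℕ.+ suc b ℕ.+ 2 ℕ.* s      ≡⟨ expand s (suc b) ⟩
  2 ℕ.* (s ℕ.+ suc b)              ∎)
  where
  open ℕ.≤-Reasoning
  expand : ∀ s b → b ℕ.+ b ℕ.+ 2 ℕ.* s ≡ 2 ℕ.* (s ℕ.+ b)
  expand = solve-∀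
... | yes b≤a =
  subst (Dim _) (sym (trans (List.length-++ (List.map top (ballots a (suc b))))
                      (cong₂ ℕ._+_ (List.length-map top (ballots a (suc b)))
                                   (List.length-map (bottom b≤a) (ballots (suc a) b)))))
    (Dim-Harmonic-suc bound (dim-Harmonic n a (suc b) s (ℕ.suc-injective eq))
      (subst (λ k → Dim (Harmonic {n} (suc s) k) (List.length (ballots (suc a) b))) (sym (ℕ.+-suc s b))
        (dim-Harmonic n (suc a) b (suc s) (trans (ℕ.suc-injective eq) (ℕ.+-suc a b)))))
  where
  open ℕ.≤-Reasoning
  expand : ∀ s b → 2 ℕ.* (s ℕ.+ b) ≡ b ℕ.+ b ℕ.+ 2 ℕ.* s
  expand = solve-∀
  bound : 2 ℕ.* (s ℕ.+ suc b) ≤ suc n ℕ.+ 2 ℕ.* s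
  bound = begin
    2 ℕ.* (s ℕ.+ suc b)              ≡⟨ expand s (suc b) ⟩
    suc b ℕ.+ suc b ℕ.+ 2 ℕ.* s      ≤⟨ ℕ.+-monoˡ-≤ (2 ℕ.* s) (ℕ.+-monoˡ-≤ (suc b) b≤a) ⟩
    suc a ℕ.+ suc b ℕ.+ 2 ℕ.* s      ≡⟨ cong (ℕ._+ 2 ℕ.* s) eq ⟨
    suc n ℕ.+ 2 ℕ.* s                ∎

-- Multiplication, contractions and the ideal

infixl 7 _⋆_ _⌟_ _⌞_

-- The grade involution, multiplying degree `d` by the sign of parity `d`. It records moving θ₁ to
-- the left past an element, which explains `σ a` in the product below.
σ : Λ n → Λ n
σ {zero}  a       = a
σ {suc n} (a , b) = σ a , ⊟ σ b

_⋆_ : Λ n → Λ n → Λ n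
_⋆_ {zero}  a       c       = a * c
_⋆_ {suc n} (a , b) (c , d) = a ⋆ c , b ⋆ c ⊞ σ a ⋆ d

dot : Λ n → Λ n → ℚ
dot {zero}  a       c       = a * c
dot {suc n} (a , b) (c , d) = dot a c + dot b d

-- The adjoints of the left and of the right multiplication by p.
_⌟_ : Λ n → Λ n → Λ n
_⌟_ {zero}  p       q       = p * q
_⌟_ {suc n} (a , b) (c , d) = a ⌟ c ⊞ b ⌟ d , σ a ⌟ d

_⌞_ : Λ n → Λ n → Λ n
_⌞_ {zero}  q       p       = q * p
_⌞_ {suc n} (c , d) (a , b) = c ⌞ a ⊞ σ (d ⌞ b) , d ⌞ a

+-interchange : ∀ a b c d → (a + b) + (c + d) ≡ (a + c) + (b + d)
+-interchange = solve 4 (λ a b c d → (a :+ b) :+ (c :+ d) := (a :+ c) :+ (b :+ d)) refl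

σ-linear : Linear (σ {n})
σ-linear {zero}  = id-linear
σ-linear {suc n} = ,-linear (∘-linear σ-linear proj₁-linear)
                            (∘-linear ⊟-linear (∘-linear σ-linear proj₂-linear))

σ-involutive : (a : Λ n) → σ (σ a) ≡ a
σ-involutive {zero}  a       = refl
σ-involutive {suc n} (a , b) = cong₂ _,_ (σ-involutive a)
  (trans (cong ⊟_ (⊟-homo σ-linear (σ b))) (trans (⊟-involutive _) (σ-involutive b)))

D∘σ : (a : Λ n) → D (σ a) ≡ ⊟ σ (D a)
D∘σ {zero}  a       = refl
D∘σ {suc n} (a , b) = cong₂ _,_
  (begin
    D (σ a) ⊞ ⊟ σ b          ≡⟨ cong (_⊞ ⊟ σ b) (D∘σ a) ⟩
    ⊟ σ (D a) ⊞ ⊟ σ b        ≡⟨ ⊟-⊞-comm _ _ ⟩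
    ⊟ (σ (D a) ⊞ σ b)        ≡⟨ cong ⊟_ (⊞-homo σ-linear _ _) ⟨
    ⊟ σ (D a ⊞ b)            ∎)
  (begin
    ⊟ D (⊟ σ b)              ≡⟨ cong ⊟_ (⊟-homo D-linear _) ⟩
    ⊟ ⊟ D (σ b)              ≡⟨ cong (λ x → ⊟ ⊟ x) (D∘σ b) ⟩
    ⊟ ⊟ ⊟ σ (D b)            ≡⟨ cong (λ x → ⊟ ⊟ x) (⊟-homo σ-linear (D b)) ⟨
    ⊟ ⊟ σ (⊟ D b)            ∎)
  where open ≡-Reasoning

W∘σ : (a : Λ n) → W (σ a) ≡ σ (W a)
W∘σ {zero}  a       = refl
W∘σ {suc n} (a , b) = cong₂ _,_
  (begin
    W (σ a) ⊞ D (⊟ σ b)      ≡⟨ cong₂ _⊞_ (W∘σ a) (⊟-homo D-linear _) ⟩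
    σ (W a) ⊞ ⊟ D (σ b)      ≡⟨ cong (λ x → σ (W a) ⊞ ⊟ x) (D∘σ b) ⟩
    σ (W a) ⊞ ⊟ ⊟ σ (D b)    ≡⟨ cong (σ (W a) ⊞_) (⊟-involutive _) ⟩
    σ (W a) ⊞ σ (D b)        ≡⟨ ⊞-homo σ-linear _ _ ⟨
    σ (W a ⊞ D b)            ∎)
  (trans (⊟-homo W-linear _) (cong ⊟_ (W∘σ b)))
  where open ≡-Reasoning

dot-comm : (a b : Λ n) → dot a b ≡ dot b a
dot-comm {zero}  a       b       = ℚ.*-comm a b
dot-comm {suc n} (a , b) (c , d) = cong₂ _+_ (dot-comm a c) (dot-comm b d)

dot-⊞ʳ : (a b c : Λ n) → dot a (b ⊞ c) ≡ dot a b + dot a c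
dot-⊞ʳ {zero}  a b c = ℚ.*-distribˡ-+ a b c
dot-⊞ʳ {suc n} (a , a′) (b , b′) (c , c′) =
  trans (cong₂ _+_ (dot-⊞ʳ a b c) (dot-⊞ʳ a′ b′ c′)) (+-interchange (dot a b) _ _ _)

dot-⊞ˡ : (a b c : Λ n) → dot (b ⊞ c) a ≡ dot b a + dot c a
dot-⊞ˡ a b c = trans (dot-comm _ a) (trans (dot-⊞ʳ a b c) (cong₂ _+_ (dot-comm a b) (dot-comm a c)))

dot-⊟ʳ : (a b : Λ n) → dot a (⊟ b) ≡ - dot a b
dot-⊟ʳ {zero}  a b = sym (ℚ.neg-distribʳ-* a b)
dot-⊟ʳ {suc n} (a , a′) (b , b′) =
  trans (cong₂ _+_ (dot-⊟ʳ a b) (dot-⊟ʳ a′ b′)) (sym (ℚ.neg-distrib-+ (dot a b) _))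

dot-𝟘ʳ : (a : Λ n) → dot a 𝟘 ≡ 0ℚ
dot-𝟘ʳ {zero}  a        = ℚ.*-zeroʳ a
dot-𝟘ʳ {suc n} (a , a′) = cong₂ _+_ (dot-𝟘ʳ a) (dot-𝟘ʳ a′)

dot-𝟘ˡ : (a : Λ n) → dot 𝟘 a ≡ 0ℚ
dot-𝟘ˡ a = trans (dot-comm 𝟘 a) (dot-𝟘ʳ a)

dot-nondegenerate : {v : Λ n} → (∀ x → dot x v ≡ 0ℚ) → v ≡ 𝟘
dot-nondegenerate {zero}  {v}     h = trans (sym (ℚ.*-identityˡ v)) (h 1ℚ)
dot-nondegenerate {suc n} {a , b} h = cong₂ _,_
  (dot-nondegenerate λ x → trans (sym (ℚ.+-identityʳ _))
    (trans (cong (dot x a +_) (sym (dot-𝟘ˡ b))) (h (x , 𝟘))))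
  (dot-nondegenerate λ x → trans (sym (ℚ.+-identityˡ _))
    (trans (cong (_+ dot x b) (sym (dot-𝟘ˡ a))) (h (𝟘 , x))))

dot-σ : (a b : Λ n) → dot (σ a) b ≡ dot a (σ b)
dot-σ {zero}  a       b       = refl
dot-σ {suc n} (a , b) (c , d) = cong₂ _+_ (dot-σ a c) (begin
  dot (⊟ σ b) d     ≡⟨ dot-comm _ d ⟩
  dot d (⊟ σ b)     ≡⟨ dot-⊟ʳ d _ ⟩
  - dot d (σ b)     ≡⟨ cong -_ (dot-comm d _) ⟩
  - dot (σ b) d     ≡⟨ cong -_ (dot-σ b d) ⟩
  - dot b (σ d)     ≡⟨ dot-⊟ʳ b _ ⟨
  dot b (⊟ σ d)     ∎)
  where open ≡-Reasoning

dot-⋆-⌟ : (p x q : Λ n) → dot (p ⋆ x) q ≡ dot x (p ⌟ q)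
dot-⋆-⌟ {zero}  p x q = solve 3 (λ p x q → (p :* x) :* q := x :* (p :* q)) refl p x q
dot-⋆-⌟ {suc n} (a , b) (x , y) (c , d) = begin
  dot (a ⋆ x) c + dot (b ⋆ x ⊞ σ a ⋆ y) d
    ≡⟨ cong (dot (a ⋆ x) c +_) (dot-⊞ˡ d _ _) ⟩
  dot (a ⋆ x) c + (dot (b ⋆ x) d + dot (σ a ⋆ y) d)
    ≡⟨ cong₂ _+_ (dot-⋆-⌟ a x c) (cong₂ _+_ (dot-⋆-⌟ b x d) (dot-⋆-⌟ (σ a) y d)) ⟩
  dot x (a ⌟ c) + (dot x (b ⌟ d) + dot y (σ a ⌟ d))
    ≡⟨ ℚ.+-assoc (dot x (a ⌟ c)) _ _ ⟨
  dot x (a ⌟ c) + dot x (b ⌟ d) + dot y (σ a ⌟ d)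
    ≡⟨ cong (_+ dot y (σ a ⌟ d)) (dot-⊞ʳ x _ _) ⟨
  dot x (a ⌟ c ⊞ b ⌟ d) + dot y (σ a ⌟ d) ∎
  where open ≡-Reasoning

dot-⋆-⌞ : (x p q : Λ n) → dot (x ⋆ p) q ≡ dot x (q ⌞ p)
dot-⋆-⌞ {zero}  x p q = solve 3 (λ x p q → (x :* p) :* q := x :* (q :* p)) refl x p q
dot-⋆-⌞ {suc n} (x , y) (a , b) (c , d) = begin
  dot (x ⋆ a) c + dot (y ⋆ a ⊞ σ x ⋆ b) d
    ≡⟨ cong (dot (x ⋆ a) c +_) (dot-⊞ˡ d _ _) ⟩
  dot (x ⋆ a) c + (dot (y ⋆ a) d + dot (σ x ⋆ b) d)
    ≡⟨ cong₂ _+_ (dot-⋆-⌞ x a c) (cong₂ _+_ (dot-⋆-⌞ y a d)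
         (trans (dot-⋆-⌞ (σ x) b d) (dot-σ x _))) ⟩
  dot x (c ⌞ a) + (dot y (d ⌞ a) + dot x (σ (d ⌞ b)))
    ≡⟨ rearrange (dot x (c ⌞ a)) _ _ ⟩
  dot x (c ⌞ a) + dot x (σ (d ⌞ b)) + dot y (d ⌞ a)
    ≡⟨ cong (_+ dot y (d ⌞ a)) (dot-⊞ʳ x _ _) ⟨
  dot x (c ⌞ a ⊞ σ (d ⌞ b)) + dot y (d ⌞ a) ∎
  where
  open ≡-Reasoning
  rearrange : ∀ a b c → a + (b + c) ≡ a + c + b
  rearrange = solve 3 (λ a b c → a :+ (b :+ c) := a :+ c :+ b) refl

⌟-linear : (p : Λ n) → Linear (p ⌟_)
⌟-linear {zero}  p       = ∙-linear p
⌟-linear {suc n} (a , b) =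
  ,-linear (⊞-linear (∘-linear (⌟-linear a) proj₁-linear) (∘-linear (⌟-linear b) proj₂-linear))
           (∘-linear (⌟-linear (σ a)) proj₂-linear)

⊟-⌟ : (p q : Λ n) → (⊟ p) ⌟ q ≡ ⊟ (p ⌟ q)
⊟-⌟ {zero}  p q = sym (ℚ.neg-distribˡ-* p q)
⊟-⌟ {suc n} (a , b) (c , d) = cong₂ _,_
  (trans (cong₂ _⊞_ (⊟-⌟ a c) (⊟-⌟ b d)) (⊟-⊞-comm _ _))
  (trans (cong (_⌟ d) (⊟-homo σ-linear a)) (⊟-⌟ (σ a) d))

⌞-linear : (p : Λ n) → Linear (_⌞ p)
⌞-linear {zero}  p = record
  { ⊞-homo = λ a b → ℚ.*-distribʳ-+ p a b ; ∙-homo = λ c a → ℚ.*-assoc c a p }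
⌞-linear {suc n} (a , b) =
  ,-linear (⊞-linear (∘-linear (⌞-linear a) proj₁-linear)
                     (∘-linear σ-linear (∘-linear (⌞-linear b) proj₂-linear)))
           (∘-linear (⌞-linear a) proj₂-linear)

⊞-swapʳ : (a b c : Λ n) → (a ⊞ b) ⊞ c ≡ (a ⊞ c) ⊞ b
⊞-swapʳ {zero}  = solve 3 (λ a b c → (a :+ b) :+ c := (a :+ c) :+ b) refl
⊞-swapʳ {suc n} a b c = cong₂ _,_ (⊞-swapʳ _ _ _) (⊞-swapʳ _ _ _)

-- Dual to `p F₁ = F₁ σ(p)`, since F 1 is odd. F 2 is even and hence central, so `W-⌟` has no `σ`.
-- Both are used to see that contraction preserves the common kernel of `D` and `W`.
D-⌟ : (p q : Λ n) → D (p ⌟ q) ≡ σ p ⌟ D q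
D-⌟ {zero}  p q = sym (ℚ.*-zeroʳ p)
D-⌟ {suc n} (a , b) (c , d) = cong₂ _,_
  (begin
    D (a ⌟ c ⊞ b ⌟ d) ⊞ σ a ⌟ d
      ≡⟨ cong (_⊞ σ a ⌟ d) (⊞-homo D-linear _ _) ⟩
    D (a ⌟ c) ⊞ D (b ⌟ d) ⊞ σ a ⌟ d
      ≡⟨ cong₂ (λ x y → x ⊞ y ⊞ σ a ⌟ d) (D-⌟ a c) (D-⌟ b d) ⟩
    σ a ⌟ D c ⊞ σ b ⌟ D d ⊞ σ a ⌟ d
      ≡⟨ ⊞-swapʳ _ _ _ ⟩
    σ a ⌟ D c ⊞ σ a ⌟ d ⊞ σ b ⌟ D d
      ≡⟨ cong₂ _⊞_ (⊞-homo (⌟-linear (σ a)) _ _)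
           (trans (⊟-⌟ (σ b) _) (trans (cong ⊟_ (⊟-homo (⌟-linear (σ b)) _)) (⊟-involutive _))) ⟨
    σ a ⌟ (D c ⊞ d) ⊞ (⊟ σ b) ⌟ (⊟ D d) ∎)
  (trans (cong ⊟_ (D-⌟ (σ a) d)) (sym (⊟-homo (⌟-linear (σ (σ a))) _)))
  where open ≡-Reasoning

W-⌟ : (p q : Λ n) → W (p ⌟ q) ≡ p ⌟ W q
W-⌟ {zero}  p q = sym (ℚ.*-zeroʳ p)
W-⌟ {suc n} (a , b) (c , d) = cong₂ _,_
  (begin
    W (a ⌟ c ⊞ b ⌟ d) ⊞ D (σ a ⌟ d)
      ≡⟨ cong₂ _⊞_ (⊞-homo W-linear _ _) (trans (D-⌟ (σ a) d) (cong (_⌟ D d) (σ-involutive a))) ⟩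
    W (a ⌟ c) ⊞ W (b ⌟ d) ⊞ a ⌟ D d
      ≡⟨ cong₂ (λ x y → x ⊞ y ⊞ a ⌟ D d) (W-⌟ a c) (W-⌟ b d) ⟩
    a ⌟ W c ⊞ b ⌟ W d ⊞ a ⌟ D d
      ≡⟨ ⊞-swapʳ _ _ _ ⟩
    a ⌟ W c ⊞ a ⌟ D d ⊞ b ⌟ W d
      ≡⟨ cong (_⊞ b ⌟ W d) (⊞-homo (⌟-linear a) _ _) ⟨
    a ⌟ (W c ⊞ D d) ⊞ b ⌟ W d ∎)
  (W-⌟ (σ a) d)
  where open ≡-Reasoning

-- Left and right multiplications commute by associativity, and so do their adjoints; no sign arises
-- here or in `W-⌞`.
D-⌞ : (q p : Λ n) → D (q ⌞ p) ≡ D q ⌞ p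
D-⌞ {zero}  q p = sym (ℚ.*-zeroˡ p)
D-⌞ {suc n} (c , d) (a , b) = cong₂ _,_
  (begin
    D (c ⌞ a ⊞ σ (d ⌞ b)) ⊞ d ⌞ a
      ≡⟨ cong (_⊞ d ⌞ a) (⊞-homo D-linear _ _) ⟩
    D (c ⌞ a) ⊞ D (σ (d ⌞ b)) ⊞ d ⌞ a
      ≡⟨ cong₂ (λ x y → x ⊞ y ⊞ d ⌞ a) (D-⌞ c a) (trans (D∘σ _) (cong (λ x → ⊟ σ x) (D-⌞ d b))) ⟩
    D c ⌞ a ⊞ ⊟ σ (D d ⌞ b) ⊞ d ⌞ a
      ≡⟨ ⊞-swapʳ _ _ _ ⟩
    D c ⌞ a ⊞ d ⌞ a ⊞ ⊟ σ (D d ⌞ b)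
      ≡⟨ cong₂ _⊞_ (⊞-homo (⌞-linear a) _ _) (⊟-homo (∘-linear σ-linear (⌞-linear b)) (D d)) ⟨
    (D c ⊞ d) ⌞ a ⊞ σ ((⊟ D d) ⌞ b) ∎)
  (trans (cong ⊟_ (D-⌞ d a)) (sym (⊟-homo (⌞-linear a) _)))
  where open ≡-Reasoning

W-⌞ : (q p : Λ n) → W (q ⌞ p) ≡ W q ⌞ p
W-⌞ {zero}  q p = sym (ℚ.*-zeroˡ p)
W-⌞ {suc n} (c , d) (a , b) = cong₂ _,_
  (begin
    W (c ⌞ a ⊞ σ (d ⌞ b)) ⊞ D (d ⌞ a)
      ≡⟨ cong₂ _⊞_ (⊞-homo W-linear _ _) (D-⌞ d a) ⟩
    W (c ⌞ a) ⊞ W (σ (d ⌞ b)) ⊞ D d ⌞ a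
      ≡⟨ cong₂ (λ x y → x ⊞ y ⊞ D d ⌞ a) (W-⌞ c a) (trans (W∘σ _) (cong σ (W-⌞ d b))) ⟩
    W c ⌞ a ⊞ σ (W d ⌞ b) ⊞ D d ⌞ a
      ≡⟨ ⊞-swapʳ _ _ _ ⟩
    W c ⌞ a ⊞ D d ⌞ a ⊞ σ (W d ⌞ b)
      ≡⟨ cong (_⊞ σ (W d ⌞ b)) (⊞-homo (⌞-linear a) _ _) ⟨
    (W c ⊞ D d) ⌞ a ⊞ σ (W d ⌞ b) ∎)
  (W-⌞ d a)
  where open ≡-Reasoning

-- The generators and their contractions

FΛ : ℕ → Λ n
FΛ {zero}  zero    = 1ℚ
FΛ {zero}  (suc r) = 0ℚ
FΛ {suc n} zero    = FΛ 0 , 𝟘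
FΛ {suc n} (suc r) = FΛ (suc r) , FΛ r

σ-F₀ : σ (FΛ {n} 0) ≡ FΛ 0
σ-F₀ {zero}  = refl
σ-F₀ {suc n} = cong₂ _,_ σ-F₀ (trans (cong ⊟_ (𝟘-homo σ-linear)) ⊟-𝟘)

σ-F₁ : σ (FΛ {n} 1) ≡ ⊟ FΛ 1
σ-F₁ {zero}  = refl
σ-F₁ {suc n} = cong₂ _,_ σ-F₁ (cong ⊟_ σ-F₀)

σ-F₂ : σ (FΛ {n} 2) ≡ FΛ 2
σ-F₂ {zero}  = refl
σ-F₂ {suc n} = cong₂ _,_ σ-F₂ (trans (cong ⊟_ σ-F₁) (⊟-involutive _))

𝟘-⌟ : (q : Λ n) → 𝟘 ⌟ q ≡ 𝟘
𝟘-⌟ {zero}  q       = ℚ.*-zeroˡ q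
𝟘-⌟ {suc n} (c , d) = cong₂ _,_ (trans (cong₂ _⊞_ (𝟘-⌟ c) (𝟘-⌟ d)) (⊞-identityˡ 𝟘))
  (trans (cong (_⌟ d) (𝟘-homo σ-linear)) (𝟘-⌟ d))

F₀-⌟ : (q : Λ n) → FΛ 0 ⌟ q ≡ q
F₀-⌟ {zero}  q       = ℚ.*-identityˡ q
F₀-⌟ {suc n} (c , d) = cong₂ _,_
  (trans (cong₂ _⊞_ (F₀-⌟ c) (𝟘-⌟ d)) (⊞-identityʳ c))
  (trans (cong (_⌟ d) σ-F₀) (F₀-⌟ d))

F₁-⌟ : (q : Λ n) → FΛ 1 ⌟ q ≡ D q
F₁-⌟ {zero}  q       = ℚ.*-zeroˡ q
F₁-⌟ {suc n} (c , d) = cong₂ _,_ (cong₂ _⊞_ (F₁-⌟ c) (F₀-⌟ d))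
  (trans (cong (_⌟ d) σ-F₁) (trans (⊟-⌟ (FΛ 1) d) (cong ⊟_ (F₁-⌟ d))))

F₂-⌟ : (q : Λ n) → FΛ 2 ⌟ q ≡ W q
F₂-⌟ {zero}  q       = ℚ.*-zeroˡ q
F₂-⌟ {suc n} (c , d) = cong₂ _,_ (cong₂ _⊞_ (F₂-⌟ c) (F₁-⌟ d))
  (trans (cong (_⌟ d) σ-F₂) (F₂-⌟ d))

double : ℕ → ℕ
double zero    = zero
double (suc k) = suc (suc (double k))

-- Dual to F (2k + 1) = F 1 F (2k).
dot-F-odd : ∀ k (q : Λ n) → dot (FΛ (suc (double k))) q ≡ dot (FΛ (double k)) (D q)
dot-F-odd {zero}  k q = trans (ℚ.*-zeroˡ q) (sym (ℚ.*-zeroʳ (FΛ (double k))))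
dot-F-odd {suc n} zero (c , d) = begin
  dot (FΛ 1) c + dot (FΛ 0) d             ≡⟨ cong (_+ dot (FΛ 0) d) (dot-F-odd 0 c) ⟩
  dot (FΛ 0) (D c) + dot (FΛ 0) d         ≡⟨ dot-⊞ʳ (FΛ 0) (D c) d ⟨
  dot (FΛ 0) (D c ⊞ d)                    ≡⟨ ℚ.+-identityʳ _ ⟨
  dot (FΛ 0) (D c ⊞ d) + 0ℚ               ≡⟨ cong (dot (FΛ 0) (D c ⊞ d) +_) (dot-𝟘ˡ (⊟ D d)) ⟨
  dot (FΛ 0) (D c ⊞ d) + dot 𝟘 (⊟ D d)    ∎
  where open ≡-Reasoning
dot-F-odd {suc n} (suc k) (c , d) = begin
  dot (FΛ (3+ 2k)) c + dot (FΛ (2+ 2k)) d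
    ≡⟨ cong (_+ dot (FΛ (2+ 2k)) d) (dot-F-odd (suc k) c) ⟩
  dot (FΛ (2+ 2k)) (D c) + dot (FΛ (2+ 2k)) d
    ≡⟨ dot-⊞ʳ (FΛ (2+ 2k)) (D c) d ⟨
  dot (FΛ (2+ 2k)) (D c ⊞ d)
    ≡⟨ ℚ.+-identityʳ _ ⟨
  dot (FΛ (2+ 2k)) (D c ⊞ d) + 0ℚ
    -- The θ₁-component contributes nothing, which is dual to F 1 squaring to zero.
    ≡⟨ cong (dot (FΛ (2+ 2k)) (D c ⊞ d) +_) (begin
         dot (FΛ (suc 2k)) (⊟ D d)       ≡⟨ dot-F-odd k (⊟ D d) ⟩
         dot (FΛ 2k) (D (⊟ D d))         ≡⟨ cong (dot (FΛ {n} 2k))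
           (trans (⊟-homo D-linear _) (trans (cong ⊟_ (D∘D≡𝟘 d)) ⊟-𝟘)) ⟩
         dot (FΛ {n} 2k) 𝟘                   ≡⟨ dot-𝟘ʳ (FΛ {n} 2k) ⟩
         0ℚ                              ∎) ⟨
  dot (FΛ (2+ 2k)) (D c ⊞ d) + dot (FΛ (suc 2k)) (⊟ D d) ∎
  where
  open ≡-Reasoning
  2k = double k
  2+_ 3+_ : ℕ → ℕ
  2+ m = suc (suc m)
  3+ m = suc (suc (suc m))

-- Dual to (k + 1) F (2k + 2) = F 2 F (2k).
dot-F-even : ∀ k (q : Λ n) →
  fromℕ (suc k) * dot (FΛ (double (suc k))) q ≡ dot (FΛ (double k)) (W q)
dot-F-even {zero} k q = trans (cong (fromℕ (suc k) *_) (ℚ.*-zeroˡ q))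
  (trans (ℚ.*-zeroʳ (fromℕ (suc k))) (sym (ℚ.*-zeroʳ (FΛ (double k)))))
dot-F-even {suc n} zero (c , d) = begin
  (1ℚ + 0ℚ) * (dot (FΛ 2) c + dot (FΛ 1) d)
    ≡⟨ ℚ.*-identityˡ _ ⟩
  dot (FΛ 2) c + dot (FΛ 1) d
    ≡⟨ cong₂ _+_ (trans (sym (ℚ.*-identityˡ (dot (FΛ 2) c))) (dot-F-even 0 c)) (dot-F-odd 0 d) ⟩
  dot (FΛ 0) (W c) + dot (FΛ 0) (D d)
    ≡⟨ dot-⊞ʳ (FΛ 0) (W c) (D d) ⟨
  dot (FΛ 0) (W c ⊞ D d)
    ≡⟨ ℚ.+-identityʳ _ ⟨
  dot (FΛ 0) (W c ⊞ D d) + 0ℚ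
    ≡⟨ cong (dot (FΛ 0) (W c ⊞ D d) +_) (dot-𝟘ˡ (W d)) ⟨
  dot (FΛ 0) (W c ⊞ D d) + dot 𝟘 (W d) ∎
  where open ≡-Reasoning
dot-F-even {suc n} (suc k) (c , d) = begin
  fromℕ (suc (suc k)) * (dot (FΛ (double (suc (suc k)))) c + dot (FΛ (suc 2k+2)) d)
    -- The factor `k + 2` of the second term is split as `1 + (k + 1)`: one copy joins `W c` to form
    -- the first component of `W`, the other `k + 1` copies yield `W d` by induction.
    ≡⟨ expand (fromℕ (suc k)) (dot (FΛ (double (suc (suc k)))) c) (dot (FΛ (suc 2k+2)) d) ⟩
  fromℕ (suc (suc k)) * dot (FΛ (double (suc (suc k)))) c + dot (FΛ (suc 2k+2)) d
    + fromℕ (suc k) * dot (FΛ (suc 2k+2)) d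
    ≡⟨ cong₂ (λ x y → x + y + fromℕ (suc k) * y) (dot-F-even (suc k) c) (dot-F-odd (suc k) d) ⟩
  dot (FΛ 2k+2) (W c) + dot (FΛ 2k+2) (D d) + fromℕ (suc k) * dot (FΛ 2k+2) (D d)
    ≡⟨ cong₂ _+_ (sym (dot-⊞ʳ (FΛ 2k+2) (W c) (D d))) (begin
         fromℕ (suc k) * dot (FΛ 2k+2) (D d)   ≡⟨ dot-F-even k (D d) ⟩
         dot (FΛ (double k)) (W (D d))         ≡⟨ cong (dot (FΛ (double k))) (D∘W≡W∘D d) ⟨
         dot (FΛ (double k)) (D (W d))         ≡⟨ dot-F-odd k (W d) ⟨
         dot (FΛ (suc (double k))) (W d)       ∎) ⟩
  dot (FΛ 2k+2) (W c ⊞ D d) + dot (FΛ (suc (double k))) (W d) ∎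
  where
  open ≡-Reasoning
  2k+2 = double (suc k)
  expand : ∀ ι x y → (1ℚ + ι) * (x + y) ≡ (1ℚ + ι) * x + y + ι * y
  expand = solve 3 (λ ι x y → (con 1ℚ :+ ι) :* (x :+ y) := (con 1ℚ :+ ι) :* x :+ y :+ ι :* y) refl

parity : ∀ r → (∃[ k ] r ≡ double k) ⊎ (∃[ k ] r ≡ suc (double k))
parity zero    = inj₁ (0 , refl)
parity (suc r) with parity r
... | inj₁ (k , refl) = inj₂ (k , refl)
... | inj₂ (k , refl) = inj₁ (suc k , refl)

dot-F≡0 : ∀ r {q : Λ n} → D q ≡ 𝟘 → W q ≡ 𝟘 → dot (FΛ (suc r)) q ≡ 0ℚ
dot-F≡0 {n} r {q} Dq≡𝟘 Wq≡𝟘 with parity r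
... | inj₁ (k , refl) =
  trans (dot-F-odd k q) (trans (cong (dot (FΛ {n} (double k))) Dq≡𝟘) (dot-𝟘ʳ (FΛ {n} (double k))))
-- Cancelling `k + 1` is where characteristic zero enters.
... | inj₂ (k , refl) = fromℕ-suc-cancel {zero} k
  (trans (dot-F-even k q) (trans (cong (dot (FΛ {n} (double k))) Wq≡𝟘) (dot-𝟘ʳ (FΛ {n} (double k)))))

-- From coefficient functions to nested pairs

∑-cong : {f g : Subset n → ℚ} → (∀ A → f A ≡ g A) → ∑ f ≡ ∑ g
∑-cong {zero}  f≗g = f≗g []
∑-cong {suc n} f≗g = cong₂ _+_ (∑-cong λ A → f≗g (outside ∷ A)) (∑-cong λ A → f≗g (inside ∷ A))

∑-zero : {f : Subset n → ℚ} → (∀ A → f A ≡ 0ℚ) → ∑ f ≡ 0ℚ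
∑-zero {zero}  f≗0 = f≗0 []
∑-zero {suc n} f≗0 = cong₂ _+_ (∑-zero λ A → f≗0 (outside ∷ A)) (∑-zero λ A → f≗0 (inside ∷ A))

∑-+ : (f g : Subset n → ℚ) → ∑ (λ A → f A + g A) ≡ ∑ f + ∑ g
∑-+ {zero}  f g = refl
∑-+ {suc n} f g = trans
  (cong₂ _+_ (∑-+ (λ A → f (outside ∷ A)) _) (∑-+ (λ A → f (inside ∷ A)) _))
  (+-interchange (∑ (λ A → f (outside ∷ A))) _ _ _)

∑-*ˡ : ∀ c (f : Subset n → ℚ) → ∑ (λ A → c * f A) ≡ c * ∑ f
∑-*ˡ {zero}  c f = refl
∑-*ˡ {suc n} c f = trans
  (cong₂ _+_ (∑-*ˡ c (λ A → f (outside ∷ A))) (∑-*ˡ c (λ A → f (inside ∷ A))))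
  (sym (ℚ.*-distribˡ-+ c _ _))

∑-*0 : ∀ (f : Subset n → ℚ) → ∑ (λ A → f A * 0ℚ) ≡ 0ℚ
∑-*0 f = ∑-zero λ A → ℚ.*-zeroʳ (f A)

∑-sift : ∀ (f : R n) B → ∑ (λ A → f A * θ A B) ≡ f B
∑-sift f []            = ℚ.*-identityʳ (f [])
∑-sift f (outside ∷ B) = trans
  (cong₂ _+_ (∑-sift (λ A → f (outside ∷ A)) B) (∑-*0 (λ A → f (inside ∷ A)))) (ℚ.+-identityʳ _)
∑-sift f (inside ∷ B)  = trans
  (cong₂ _+_ (∑-*0 (λ A → f (outside ∷ A))) (∑-sift (λ A → f (inside ∷ A)) B)) (ℚ.+-identityˡ _)

toΛ : R n → Λ n
toΛ {zero}  p = p []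
toΛ {suc n} p = toΛ (λ A → p (outside ∷ A)) , toΛ (λ A → p (inside ∷ A))

fromΛ : Λ n → R n
fromΛ a       []            = a
fromΛ (a , b) (outside ∷ A) = fromΛ a A
fromΛ (a , b) (inside ∷ A)  = fromΛ b A

toΛ-cong : {p q : R n} → p ≈ q → toΛ p ≡ toΛ q
toΛ-cong {zero}  p≈q = p≈q []
toΛ-cong {suc n} p≈q = cong₂ _,_ (toΛ-cong λ A → p≈q (outside ∷ A)) (toΛ-cong λ A → p≈q (inside ∷ A))

toΛ-fromΛ : (a : Λ n) → toΛ (fromΛ a) ≡ a
toΛ-fromΛ {zero}  a       = refl
toΛ-fromΛ {suc n} (a , b) = cong₂ _,_ (toΛ-fromΛ a) (toΛ-fromΛ b)

fromΛ-toΛ : (p : R n) → fromΛ (toΛ p) ≈ p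
fromΛ-toΛ p []            = refl
fromΛ-toΛ p (outside ∷ A) = fromΛ-toΛ (λ A → p (outside ∷ A)) A
fromΛ-toΛ p (inside ∷ A)  = fromΛ-toΛ (λ A → p (inside ∷ A)) A

toΛ-⊕ : (p q : R n) → toΛ (p ⊕ q) ≡ toΛ p ⊞ toΛ q
toΛ-⊕ {zero}  p q = refl
toΛ-⊕ {suc n} p q = cong₂ _,_ (toΛ-⊕ (λ A → p (outside ∷ A)) _) (toΛ-⊕ (λ A → p (inside ∷ A)) _)

toΛ-𝟎 : toΛ {n} 𝟎 ≡ 𝟘
toΛ-𝟎 {zero}  = refl
toΛ-𝟎 {suc n} = cong₂ _,_ toΛ-𝟎 toΛ-𝟎

gradeInvolution : R n → R n
gradeInvolution p A = (-1^ ∣ A ∣) * p A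

toΛ-neg : (p : R n) → toΛ (λ A → - p A) ≡ ⊟ toΛ p
toΛ-neg {zero}  p = refl
toΛ-neg {suc n} p = cong₂ _,_ (toΛ-neg λ A → p (outside ∷ A)) (toΛ-neg λ A → p (inside ∷ A))

toΛ-gradeInvolution : (p : R n) → toΛ (gradeInvolution p) ≡ σ (toΛ p)
toΛ-gradeInvolution {zero}  p = ℚ.*-identityˡ (p [])
toΛ-gradeInvolution {suc n} p = cong₂ _,_
  (toΛ-gradeInvolution λ A → p (outside ∷ A))
  (begin
    toΛ (λ A → - (-1^ ∣ A ∣) * p (inside ∷ A))
      ≡⟨ toΛ-cong (λ A → sym (ℚ.neg-distribˡ-* (-1^ ∣ A ∣) (p (inside ∷ A)))) ⟩
    toΛ (λ A → - ((-1^ ∣ A ∣) * p (inside ∷ A)))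
      ≡⟨ toΛ-neg (gradeInvolution λ A → p (inside ∷ A)) ⟩
    ⊟ toΛ (gradeInvolution λ A → p (inside ∷ A))
      ≡⟨ cong ⊟_ (toΛ-gradeInvolution λ A → p (inside ∷ A)) ⟩
    ⊟ σ (toΛ λ A → p (inside ∷ A)) ∎)
  where open ≡-Reasoning

-- Products of monomials and of elements

Nonempty-outside : ∀ {A : Subset n} → Nonempty (outside ∷ A) ⇔ Nonempty A
Nonempty-outside = mk⇔ (λ { (suc i , there i∈A) → i , i∈A }) (λ (i , i∈A) → suc i , there i∈A)

does-nonempty-outside : (A : Subset n) → does (nonempty? (outside ∷ A)) ≡ does (nonempty? A)
does-nonempty-outside A = does-⇔ Nonempty-outside (nonempty? (outside ∷ A)) (nonempty? A)

-1^-+ : ∀ k l → -1^ (k ℕ.+ l) ≡ (-1^ k) * (-1^ l)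
-1^-+ zero    l = sym (ℚ.*-identityˡ _)
-1^-+ (suc k) l = trans (cong -_ (-1^-+ k l)) (ℚ.neg-distribˡ-* (-1^ k) (-1^ l))

-- Evaluation at `C` is moved inside the conditional, so that the branches are numbers and can be
-- rewritten together with the Boolean.
mul : Subset n → Subset n → Subset n → ℚ
mul A B C = if does (nonempty? (A ∩ B)) then 0ℚ else (-1^ inversions A B) * θ (A ∪ B) C

mulMonomials≡mul : (A B C : Subset n) → mulMonomials A B C ≡ mul A B C
mulMonomials≡mul A B C =
  if-float (λ (p : R _) → p C) (does (nonempty? (A ∩ B))) {𝟎} {(-1^ inversions A B) • θ (A ∪ B)}

if-same : ∀ b {x : ℚ} → (if b then x else x) ≡ x
if-same false = refl
if-same true  = refl

module _ {n} (A B C : Subset n) where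

  open ≡-Reasoning

  private
    mul-zero : ∀ x {y} z → y ≡ 0ℚ → (if x then 0ℚ else z * y) ≡ 0ℚ
    mul-zero true  z refl = refl
    mul-zero false z refl = ℚ.*-zeroʳ z

  mul-outside-outside-outside :
    mulMonomials (outside ∷ A) (outside ∷ B) (outside ∷ C) ≡ mulMonomials A B C
  mul-outside-outside-outside = trans (mulMonomials≡mul (outside ∷ A) (outside ∷ B) (outside ∷ C))
    (trans (cong (if_then 0ℚ else (-1^ inversions A B) * θ (A ∪ B) C) (does-nonempty-outside (A ∩ B)))
           (sym (mulMonomials≡mul A B C)))

  mul-outside-outside-inside :
    mulMonomials (outside ∷ A) (outside ∷ B) (inside ∷ C) ≡ 0ℚ
  mul-outside-outside-inside = trans (mulMonomials≡mul (outside ∷ A) (outside ∷ B) (inside ∷ C))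
    (mul-zero (does (nonempty? (outside ∷ (A ∩ B)))) (-1^ inversions A B) refl)

  mul-inside-outside-outside :
    mulMonomials (inside ∷ A) (outside ∷ B) (outside ∷ C) ≡ 0ℚ
  mul-inside-outside-outside = trans (mulMonomials≡mul (inside ∷ A) (outside ∷ B) (outside ∷ C))
    (mul-zero (does (nonempty? (outside ∷ (A ∩ B)))) (-1^ inversions A B) refl)

  mul-inside-outside-inside :
    mulMonomials (inside ∷ A) (outside ∷ B) (inside ∷ C) ≡ mulMonomials A B C
  mul-inside-outside-inside = trans (mulMonomials≡mul (inside ∷ A) (outside ∷ B) (inside ∷ C))
    (trans (cong (if_then 0ℚ else (-1^ inversions A B) * θ (A ∪ B) C) (does-nonempty-outside (A ∩ B)))
           (sym (mulMonomials≡mul A B C)))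

  mul-outside-inside-outside :
    mulMonomials (outside ∷ A) (inside ∷ B) (outside ∷ C) ≡ 0ℚ
  mul-outside-inside-outside = trans (mulMonomials≡mul (outside ∷ A) (inside ∷ B) (outside ∷ C))
    (mul-zero (does (nonempty? (outside ∷ (A ∩ B)))) (-1^ (∣ A ∣ ℕ.+ inversions A B)) refl)

  -- The sign is the price of moving the new first variable from the second factor past all of
  -- `θ_A`; it becomes the `σ` of `_⋆_`.
  mul-outside-inside-inside :
    mulMonomials (outside ∷ A) (inside ∷ B) (inside ∷ C) ≡ (-1^ ∣ A ∣) * mulMonomials A B C
  mul-outside-inside-inside = begin
    mulMonomials (outside ∷ A) (inside ∷ B) (inside ∷ C)
      ≡⟨ mulMonomials≡mul (outside ∷ A) (inside ∷ B) (inside ∷ C) ⟩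
    (if does (nonempty? (outside ∷ (A ∩ B))) then 0ℚ else (-1^ (∣ A ∣ ℕ.+ inversions A B)) * θ (A ∪ B) C)
      ≡⟨ cong₂ (if_then 0ℚ else_) (does-nonempty-outside (A ∩ B))
           (trans (cong (_* θ (A ∪ B) C) (-1^-+ ∣ A ∣ (inversions A B))) (ℚ.*-assoc (-1^ ∣ A ∣) _ _)) ⟩
    (if b then 0ℚ else (-1^ ∣ A ∣) * m)
      ≡⟨ cong (if b then_else (-1^ ∣ A ∣) * m) (ℚ.*-zeroʳ (-1^ ∣ A ∣)) ⟨
    (if b then (-1^ ∣ A ∣) * 0ℚ else (-1^ ∣ A ∣) * m)
      ≡⟨ if-float ((-1^ ∣ A ∣) *_) b ⟨
    (-1^ ∣ A ∣) * mul A B C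
      ≡⟨ cong ((-1^ ∣ A ∣) *_) (mulMonomials≡mul A B C) ⟨
    (-1^ ∣ A ∣) * mulMonomials A B C ∎
    where
    b = does (nonempty? (A ∩ B))
    m = (-1^ inversions A B) * θ (A ∪ B) C

toΛ-⊛ : (p q : R n) → toΛ (p ⊛ q) ≡ toΛ p ⋆ toΛ q
toΛ-⊛ {zero}  p q = cong (p [] *_) (trans (cong (q [] *_) (ℚ.*-identityʳ 1ℚ)) (ℚ.*-identityʳ _))
toΛ-⊛ {suc n} p q = cong₂ _,_
  (trans (toΛ-cong outside-component) (toΛ-⊛ p₀ q₀))
  (begin
    toΛ (λ C → (p ⊛ q) (inside ∷ C))
      ≡⟨ toΛ-cong inside-component ⟩
    toΛ (p₁ ⊛ q₀ ⊕ gradeInvolution p₀ ⊛ q₁)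
      ≡⟨ toΛ-⊕ (p₁ ⊛ q₀) _ ⟩
    toΛ (p₁ ⊛ q₀) ⊞ toΛ (gradeInvolution p₀ ⊛ q₁)
      ≡⟨ cong₂ _⊞_ (toΛ-⊛ p₁ q₀) (toΛ-⊛ (gradeInvolution p₀) q₁) ⟩
    toΛ p₁ ⋆ toΛ q₀ ⊞ toΛ (gradeInvolution p₀) ⋆ toΛ q₁
      ≡⟨ cong (λ x → toΛ p₁ ⋆ toΛ q₀ ⊞ x ⋆ toΛ q₁) (toΛ-gradeInvolution p₀) ⟩
    toΛ p₁ ⋆ toΛ q₀ ⊞ σ (toΛ p₀) ⋆ toΛ q₁ ∎)
  where
  open ≡-Reasoning
  p₀ p₁ q₀ q₁ : R n
  p₀ A = p (outside ∷ A)
  p₁ A = p (inside ∷ A)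
  q₀ A = q (outside ∷ A)
  q₁ A = q (inside ∷ A)

  row : R n → Subset n → Subset n → ℚ
  row q A C = ∑ (λ B → q B * mulMonomials A B C)

  outside-component : ∀ C → (p ⊛ q) (outside ∷ C) ≡ (p₀ ⊛ q₀) C
  outside-component C = trans
    (cong₂ _+_
      (∑-cong λ A → cong (p₀ A *_) (trans (cong₂ _+_
        (∑-cong λ B → cong (q₀ B *_) (mul-outside-outside-outside A B C))
        (∑-zero λ B → trans (cong (q₁ B *_) (mul-outside-inside-outside A B C)) (ℚ.*-zeroʳ (q₁ B))))
        (ℚ.+-identityʳ (row q₀ A C))))
      (∑-zero λ A → trans (cong (p₁ A *_) (cong₂ _+_
        (∑-zero λ B → trans (cong (q₀ B *_) (mul-inside-outside-outside A B C)) (ℚ.*-zeroʳ (q₀ B)))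
        (∑-*0 q₁)))
        (ℚ.*-zeroʳ (p₁ A))))
    (ℚ.+-identityʳ _)

  inside-component : ∀ C → (p ⊛ q) (inside ∷ C) ≡ (p₁ ⊛ q₀ ⊕ gradeInvolution p₀ ⊛ q₁) C
  inside-component C = trans
    (cong₂ _+_
      (∑-cong λ A → begin
        p₀ A * (∑ (λ B → q₀ B * mulMonomials (outside ∷ A) (outside ∷ B) (inside ∷ C))
              + ∑ (λ B → q₁ B * mulMonomials (outside ∷ A) (inside ∷ B) (inside ∷ C)))
          ≡⟨ cong (p₀ A *_) (cong₂ _+_
               (∑-zero λ B → trans (cong (q₀ B *_) (mul-outside-outside-inside A B C)) (ℚ.*-zeroʳ (q₀ B)))
               (trans (∑-cong λ B → trans (cong (q₁ B *_) (mul-outside-inside-inside A B C))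
                                          (swap (q₁ B) (-1^ ∣ A ∣) (mulMonomials A B C)))
                      (∑-*ˡ (-1^ ∣ A ∣) (λ B → q₁ B * mulMonomials A B C)))) ⟩
        p₀ A * (0ℚ + (-1^ ∣ A ∣) * row q₁ A C)
          ≡⟨ rearrange (p₀ A) (-1^ ∣ A ∣) (row q₁ A C) ⟩
        (-1^ ∣ A ∣) * p₀ A * row q₁ A C ∎)
      (∑-cong λ A → cong (p₁ A *_) (trans (cong₂ _+_
        (∑-cong λ B → cong (q₀ B *_) (mul-inside-outside-inside A B C))
        (∑-*0 q₁))
        (ℚ.+-identityʳ (row q₀ A C)))))
    (ℚ.+-comm ((gradeInvolution p₀ ⊛ q₁) C) _)
    where
    swap : ∀ x y z → x * (y * z) ≡ y * (x * z)
    swap = solve 3 (λ x y z → x :* (y :* z) := y :* (x :* z)) refl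
    rearrange : ∀ x y z → x * (0ℚ + y * z) ≡ y * x * z
    rearrange = solve 3 (λ x y z → x :* (con 0ℚ :+ y :* z) := y :* x :* z) refl

toΛ-F : ∀ r → toΛ {n} (F r) ≡ FΛ r
toΛ-F {zero}  zero    = refl
toΛ-F {zero}  (suc r) = refl
toΛ-F {suc n} zero    = cong₂ _,_
  (trans (toΛ-cong λ B → trans (cong (F {n} 0 B +_) (∑-zero {n} λ A → refl)) (ℚ.+-identityʳ _)) (toΛ-F {n} 0))
  (trans (toΛ-cong λ B → cong₂ _+_ (∑-zero {n} λ A → if-same (∣ A ∣ ≡ᵇ 0)) (∑-zero {n} λ A → refl)) toΛ-𝟎)
toΛ-F {suc n} (suc r) = cong₂ _,_
  (trans (toΛ-cong λ B → trans (cong (F {n} (suc r) B +_) (∑-zero {n} λ A → if-same (∣ A ∣ ≡ᵇ r)))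
                               (ℚ.+-identityʳ _))
         (toΛ-F (suc r)))
  (trans (toΛ-cong λ B → trans (cong (_+ F {n} r B) (∑-zero {n} λ A → if-same (∣ A ∣ ≡ᵇ suc r)))
                               (ℚ.+-identityˡ _))
         (toΛ-F r))

-- Iterated derivatives and the inner product

∂-zero : ∀ (q : R (suc n)) B → ∂ zero q (outside ∷ B) ≡ q (inside ∷ B)
∂-zero q B = trans (cong₂ _+_
  (∑-*0 λ A → q (outside ∷ A))
  (trans (∑-cong λ A → cong (q (inside ∷ A) *_)
           (trans (ℚ.*-identityˡ _) (cong (λ A → θ A B) (p─⊥≡p A))))
         (∑-sift (λ A → q (inside ∷ A)) B)))
  (ℚ.+-identityˡ _)

∂-suc : ∀ i (q : R (suc n)) B → ∂ (suc i) q (outside ∷ B) ≡ ∂ i (λ A → q (outside ∷ A)) B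
∂-suc i q B = trans (cong₂ _+_
  (∑-cong λ A → cong (q (outside ∷ A) *_) (same A))
  (∑-zero λ A → trans (cong (q (inside ∷ A) *_) (vanish A)) (ℚ.*-zeroʳ (q (inside ∷ A)))))
  (ℚ.+-identityʳ _)
  where
  same : ∀ A →
    (if does (i ∈? A) then (-1^ countBelow i A) • θ (outside ∷ (A - i)) else 𝟎) (outside ∷ B)
      ≡ (if does (i ∈? A) then (-1^ countBelow i A) • θ (A - i) else 𝟎) B
  same A with does (i ∈? A)
  ... | true  = refl
  ... | false = refl
  vanish : ∀ A →
    (if does (i ∈? A) then (-1^ suc (countBelow i A)) • θ (inside ∷ (A - i)) else 𝟎) (outside ∷ B)
      ≡ 0ℚ
  vanish A with does (i ∈? A)
  ... | true  = ℚ.*-zeroʳ (-1^ suc (countBelow i A))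
  ... | false = refl

∂-cong : ∀ i {p q : R n} → p ≈ q → ∂ i p ≈ ∂ i q
∂-cong i p≈q B = ∑-cong λ A → cong (_* _) (p≈q A)

∂-word-cong : ∀ is {p q : R n} → p ≈ q → ∂-word is p ≈ ∂-word is q
∂-word-cong []       p≈q = p≈q
∂-word-cong (i ∷ is) p≈q = ∂-cong i (∂-word-cong is p≈q)

∂-word-map-suc : ∀ is (q : R (suc n)) B →
  ∂-word (List.map suc is) q (outside ∷ B) ≡ ∂-word is (λ A → q (outside ∷ A)) B
∂-word-map-suc []       q B = refl
∂-word-map-suc (i ∷ is) q B =
  trans (∂-suc i (∂-word (List.map suc is) q) B) (∂-cong i (∂-word-map-suc is q) B)

filter-map-suc : ∀ x (A : Subset n) is →
  List.filter (_∈? (x ∷ A)) (List.map suc is) ≡ List.map suc (List.filter (_∈? A) is)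
filter-map-suc x A []       = refl
filter-map-suc x A (i ∷ is) with does (i ∈? A)
... | true  = cong (suc i ∷_) (filter-map-suc x A is)
... | false = filter-map-suc x A is

filter-tabulate-suc : ∀ x (A : Subset n) →
  List.filter (_∈? (x ∷ A)) (List.tabulate suc) ≡ List.map suc (elements A)
filter-tabulate-suc x A = trans
  (cong (List.filter (_∈? (x ∷ A))) (sym (List.map-tabulate (λ i → i) suc)))
  (filter-map-suc x A (List.allFin _))

-- The reversal makes the smallest index act first. Every derivative then removes the first variable
-- still present, so no sign appears, and the later ones act within the remaining variables. This is
-- the orthonormality of the monomials.
∂-word-elements : ∀ A (q : R n) → ∂-word (List.reverse (elements A)) q ⊥ ≡ q A
∂-word-elements []            q = refl
∂-word-elements (outside ∷ A) q = begin
  ∂-word (List.reverse (elements (outside ∷ A))) q ⊥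
    ≡⟨ cong (λ is → ∂-word (List.reverse is) q ⊥) (filter-tabulate-suc outside A) ⟩
  ∂-word (List.reverse (List.map suc (elements A))) q ⊥
    ≡⟨ cong (λ is → ∂-word is q ⊥) (List.reverse-map suc (elements A)) ⟨
  ∂-word (List.map suc (List.reverse (elements A))) q ⊥
    ≡⟨ ∂-word-map-suc (List.reverse (elements A)) q ⊥ ⟩
  ∂-word (List.reverse (elements A)) (λ B → q (outside ∷ B)) ⊥
    ≡⟨ ∂-word-elements A (λ B → q (outside ∷ B)) ⟩
  q (outside ∷ A) ∎
  where open ≡-Reasoning
∂-word-elements (inside ∷ A) q = begin
  ∂-word (List.reverse (elements (inside ∷ A))) q ⊥
    ≡⟨ cong (λ is → ∂-word (List.reverse (zero ∷ is)) q ⊥) (filter-tabulate-suc inside A) ⟩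
  ∂-word (List.reverse (zero ∷ List.map suc (elements A))) q ⊥
    ≡⟨ cong (λ is → ∂-word is q ⊥) (List.unfold-reverse zero (List.map suc (elements A))) ⟩
  ∂-word (List.reverse (List.map suc (elements A)) List.∷ʳ zero) q ⊥
    ≡⟨ cong (λ is → ∂-word (is List.∷ʳ zero) q ⊥) (List.reverse-map suc (elements A)) ⟨
  ∂-word (List.map suc (List.reverse (elements A)) List.∷ʳ zero) q ⊥
    ≡⟨ cong (λ p → p ⊥) (List.foldr-++ ∂ q (List.map suc (List.reverse (elements A))) (zero ∷ [])) ⟩
  ∂-word (List.map suc (List.reverse (elements A))) (∂ zero q) ⊥
    ≡⟨ ∂-word-map-suc (List.reverse (elements A)) (∂ zero q) ⊥ ⟩
  ∂-word (List.reverse (elements A)) (λ B → ∂ zero q (outside ∷ B)) ⊥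
    ≡⟨ ∂-word-cong (List.reverse (elements A)) (∂-zero q) ⊥ ⟩
  ∂-word (List.reverse (elements A)) (λ B → q (inside ∷ B)) ⊥
    ≡⟨ ∂-word-elements A (λ B → q (inside ∷ B)) ⟩
  q (inside ∷ A) ∎
  where open ≡-Reasoning

∑-*≡dot : (p q : R n) → ∑ (λ A → p A * q A) ≡ dot (toΛ p) (toΛ q)
∑-*≡dot {zero}  p q = refl
∑-*≡dot {suc n} p q = cong₂ _+_
  (∑-*≡dot (λ A → p (outside ∷ A)) (λ A → q (outside ∷ A)))
  (∑-*≡dot (λ A → p (inside ∷ A)) (λ A → q (inside ∷ A)))

⟨⟩≡dot : (p q : R n) → ⟨ p , q ⟩ ≡ dot (toΛ p) (toΛ q)
⟨⟩≡dot p q = trans (∑-cong λ A → cong (p A *_) (∂-word-elements A q)) (∑-*≡dot p q)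

-- `EQH` as the common kernel of `D` and `W`

dot-ideal : ∀ {p : R n} {v : Λ n} → I n p → D v ≡ 𝟘 → W v ≡ 𝟘 → dot (toΛ p) v ≡ 0ℚ
dot-ideal {v = v} (gen (suc r , _ , _ , refl)) Dv Wv =
  trans (cong (λ p → dot p v) (toΛ-F (suc r))) (dot-F≡0 r Dv Wv)
dot-ideal {v = v} zero Dv Wv = trans (cong (λ p → dot p v) toΛ-𝟎) (dot-𝟘ˡ v)
dot-ideal {v = v} (add {p} {q} p∈I q∈I) Dv Wv = begin
  dot (toΛ (p ⊕ q)) v               ≡⟨ cong (λ x → dot x v) (toΛ-⊕ p q) ⟩
  dot (toΛ p ⊞ toΛ q) v             ≡⟨ dot-⊞ˡ v _ _ ⟩
  dot (toΛ p) v + dot (toΛ q) v     ≡⟨ cong₂ _+_ (dot-ideal p∈I Dv Wv) (dot-ideal q∈I Dv Wv) ⟩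
  0ℚ                                ∎
  where open ≡-Reasoning
dot-ideal {v = v} (mulˡ p {q} q∈I) Dv Wv = begin
  dot (toΛ (p ⊛ q)) v               ≡⟨ cong (λ x → dot x v) (toΛ-⊛ p q) ⟩
  dot (toΛ p ⋆ toΛ q) v             ≡⟨ dot-⋆-⌟ (toΛ p) (toΛ q) v ⟩
  -- The factor `p` is moved to the other side, where it replaces `v` by another vector of the
  -- common kernel; hence the induction runs over all `v` at once.
  dot (toΛ q) (toΛ p ⌟ v)           ≡⟨ dot-ideal q∈I
    (trans (D-⌟ (toΛ p) v) (trans (cong (σ (toΛ p) ⌟_) Dv) (Linear.𝟘-homo (⌟-linear (σ (toΛ p))))))
    (trans (W-⌟ (toΛ p) v) (trans (cong (toΛ p ⌟_) Wv) (Linear.𝟘-homo (⌟-linear (toΛ p))))) ⟩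
  0ℚ                                ∎
  where open ≡-Reasoning
dot-ideal {v = v} (mulʳ {p} q p∈I) Dv Wv = begin
  dot (toΛ (p ⊛ q)) v               ≡⟨ cong (λ x → dot x v) (toΛ-⊛ p q) ⟩
  dot (toΛ p ⋆ toΛ q) v             ≡⟨ dot-⋆-⌞ (toΛ p) (toΛ q) v ⟩
  dot (toΛ p) (v ⌞ toΛ q)           ≡⟨ dot-ideal p∈I
    (trans (D-⌞ v (toΛ q)) (trans (cong (_⌞ toΛ q) Dv) (Linear.𝟘-homo (⌞-linear (toΛ q)))))
    (trans (W-⌞ v (toΛ q)) (trans (cong (_⌞ toΛ q) Wv) (Linear.𝟘-homo (⌞-linear (toΛ q))))) ⟩
  0ℚ                                ∎
  where open ≡-Reasoning
dot-ideal {v = v} (resp p≈q p∈I) Dv Wv =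
  trans (cong (λ x → dot x v) (sym (toΛ-cong p≈q))) (dot-ideal p∈I Dv Wv)

EQH⇒F-⌟ : ∀ {q : R n} → EQH n q → ∀ {r} → 1 ≤ r → r ≤ n → FΛ r ⌟ toΛ q ≡ 𝟘
EQH⇒F-⌟ {n} {q} q∈EQH {r} 1≤r r≤n = dot-nondegenerate λ x → begin
  dot x (FΛ r ⌟ toΛ q)                    ≡⟨ dot-⋆-⌟ (FΛ r) x (toΛ q) ⟨
  dot (FΛ r ⋆ x) (toΛ q)                  ≡⟨ cong₂ (λ y z → dot (y ⋆ z) (toΛ q)) (toΛ-F r) (toΛ-fromΛ x) ⟨
  dot (toΛ (F r) ⋆ toΛ (fromΛ x)) (toΛ q) ≡⟨ cong (λ y → dot y (toΛ q)) (toΛ-⊛ (F r) (fromΛ x)) ⟨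
  dot (toΛ (F r ⊛ fromΛ x)) (toΛ q)       ≡⟨ ⟨⟩≡dot (F r ⊛ fromΛ x) q ⟨
  ⟨ F r ⊛ fromΛ x , q ⟩                   ≡⟨ q∈EQH _ (mulʳ (fromΛ x) (gen (r , 1≤r , r≤n , refl))) ⟩
  0ℚ                                      ∎
  where open ≡-Reasoning

EQH⇔ : 1 ≤ n → (q : R n) → EQH n q ⇔ (D (toΛ q) ≡ 𝟘 × W (toΛ q) ≡ 𝟘)
EQH⇔ {n} 1≤n q = mk⇔
  (λ q∈EQH → trans (sym (F₁-⌟ (toΛ q))) (EQH⇒F-⌟ q∈EQH (s≤s z≤n) 1≤n) , W≡𝟘 1≤n q∈EQH)
  (λ (Dq , Wq) p p∈I → trans (⟨⟩≡dot p q) (dot-ideal p∈I Dq Wq))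
  where
  W≡𝟘 : ∀ {n} {q : R n} → 1 ≤ n → EQH n q → W (toΛ q) ≡ 𝟘
  -- In one variable F 2 is not among the generators, but there `W` is zero by computation.
  W≡𝟘 {suc zero}    _ _     = refl
  W≡𝟘 {suc (suc n)} {q} _ q∈EQH = trans (sym (F₂-⌟ (toΛ q))) (EQH⇒F-⌟ q∈EQH (s≤s z≤n) (s≤s (s≤s z≤n)))

-- Degrees and dimensions in the two descriptions

Homogeneous⇒H : ∀ s k (p : R n) → (∀ A → s ℕ.+ ∣ A ∣ ≢ k → p A ≡ 0ℚ) → H s k (toΛ p)
Homogeneous⇒H {zero}  s k p h s≢k = h [] (λ eq → s≢k (trans (sym (ℕ.+-identityʳ s)) eq))
Homogeneous⇒H {suc n} s k p h =
  Homogeneous⇒H s k _ (λ A → h (outside ∷ A)) ,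
  Homogeneous⇒H (suc s) k _ (λ A ≢k → h (inside ∷ A) (λ eq → ≢k (trans (sym (ℕ.+-suc s ∣ A ∣)) eq)))

H⇒Homogeneous : ∀ s k (p : R n) → H s k (toΛ p) → ∀ A → s ℕ.+ ∣ A ∣ ≢ k → p A ≡ 0ℚ
H⇒Homogeneous s k p h []            ≢k = h (λ eq → ≢k (trans (ℕ.+-identityʳ s) eq))
H⇒Homogeneous s k p h (outside ∷ A) ≢k = H⇒Homogeneous s k _ (proj₁ h) A ≢k
H⇒Homogeneous s k p h (inside ∷ A)  ≢k =
  H⇒Homogeneous (suc s) k _ (proj₂ h) A (λ eq → ≢k (trans (ℕ.+-suc s ∣ A ∣) eq))

EQH∩Homogeneous⇔Harmonic : ∀ k → 1 ≤ n → (q : R n) →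
  (EQH n q × Homogeneous k q) ⇔ Harmonic 0 k (toΛ q)
EQH∩Homogeneous⇔Harmonic k 1≤n q = mk⇔
  (λ (e , h) → let (Dq , Wq) = Equivalence.to (EQH⇔ 1≤n q) e in Dq , Wq , Homogeneous⇒H 0 k q h)
  (λ (Dq , Wq , h) → Equivalence.from (EQH⇔ 1≤n q) (Dq , Wq) , H⇒Homogeneous 0 k q h)

fromΛ-𝟘 : fromΛ {n} 𝟘 ≈ 𝟎
fromΛ-𝟘 []            = refl
fromΛ-𝟘 (outside ∷ A) = fromΛ-𝟘 A
fromΛ-𝟘 (inside ∷ A)  = fromΛ-𝟘 A

fromΛ-⊞ : (a b : Λ n) → fromΛ (a ⊞ b) ≈ fromΛ a ⊕ fromΛ b
fromΛ-⊞ a b []            = refl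
fromΛ-⊞ a b (outside ∷ A) = fromΛ-⊞ _ _ A
fromΛ-⊞ a b (inside ∷ A)  = fromΛ-⊞ _ _ A

fromΛ-∙ : ∀ c (a : Λ n) → fromΛ (c ∙ a) ≈ c • fromΛ a
fromΛ-∙ c a []            = refl
fromΛ-∙ c a (outside ∷ A) = fromΛ-∙ c _ A
fromΛ-∙ c a (inside ∷ A)  = fromΛ-∙ c _ A

linComb≈lc : ∀ {d} (c : Fin d → ℚ) (vs : Vec (Λ n) d) →
  linComb c (fromΛ ∘ lookup vs) ≈ fromΛ (lc (Vec.tabulate c) vs)
linComb≈lc c []       A = sym (fromΛ-𝟘 A)
linComb≈lc c (v ∷ vs) A = trans
  (cong₂ _+_ (sym (fromΛ-∙ (c zero) v A)) (linComb≈lc (c ∘ suc) vs A))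
  (sym (fromΛ-⊞ (c zero ∙ v) _ A))

HasDim-Λ : ∀ {P : R n → Set} {V : Λ n → Set} {d} →
  (∀ p → P p ⇔ V (toΛ p)) → Dim V d → HasDim P d
HasDim-Λ {V = V} P⇔V dim = record
  { basis       = fromΛ ∘ lookup basis
  ; basis∈V     = λ i → Equivalence.from (P⇔V _) (subst V (sym (toΛ-fromΛ _)) (All.lookup⁺ basis∈V i))
  ; independent = λ c eq i → begin
      c i                             ≡⟨ Vec.lookup∘tabulate c i ⟨
      lookup (Vec.tabulate c) i       ≡⟨ cong (λ cs → lookup cs i) (independent (Vec.tabulate c) (begin
        lc (Vec.tabulate c) basis                  ≡⟨ toΛ-fromΛ _ ⟨
        toΛ (fromΛ (lc (Vec.tabulate c) basis))    ≡⟨ toΛ-cong (λ A → trans (sym (linComb≈lc c basis A)) (eq A)) ⟩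
        toΛ 𝟎                                      ≡⟨ toΛ-𝟎 ⟩
        𝟘                                          ∎)) ⟩
      lookup (Vec.replicate _ 0ℚ) i   ≡⟨ Vec.lookup-replicate i 0ℚ ⟩
      0ℚ                              ∎
  ; spanning    = λ p p∈P → let (cs , eq) = spanning (toΛ p) (Equivalence.to (P⇔V p) p∈P) in
      lookup cs , λ A → begin
        p A                                            ≡⟨ fromΛ-toΛ p A ⟨
        fromΛ (toΛ p) A                                ≡⟨ cong (λ v → fromΛ v A) eq ⟩
        fromΛ (lc cs basis) A                          ≡⟨ cong (λ cs → fromΛ (lc cs basis) A) (Vec.tabulate∘lookup cs) ⟨
        fromΛ (lc (Vec.tabulate (lookup cs)) basis) A  ≡⟨ linComb≈lc (lookup cs) basis A ⟨
        linComb (lookup cs) (fromΛ ∘ lookup basis) A   ∎ }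
  where
  open Dim dim
  open ≡-Reasoning

-- Standard tableaux with two rows

private variable
  a b N : ℕ
  u v : ℕ → ℕ

Ballot⇒≤ : Ballot a b → b ≤ a
Ballot⇒≤ []           = z≤n
Ballot⇒≤ (top s)      = ℕ.m≤n⇒m≤1+n (Ballot⇒≤ s)
Ballot⇒≤ (bottom p _) = p

ballots-complete : (s : Ballot a b) → s ∈ ballots a b
ballots-complete []                     = here refl
ballots-complete (top {a} {zero} s)     = ∈-map⁺ top (ballots-complete s)
ballots-complete (top {a} {suc b} s) with suc b ℕ.≤? suc a
... | yes _  = ∈-++⁺ˡ (∈-map⁺ top (ballots-complete s))
... | no b≰a = contradiction (ℕ.m≤n⇒m≤1+n (Ballot⇒≤ s)) b≰a
ballots-complete (bottom {suc a} {b} p s) with suc b ℕ.≤? suc a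
... | yes q rewrite ℕ.≤-irrelevant p q =
  ∈-++⁺ʳ (List.map top (ballots a (suc b))) (∈-map⁺ (bottom q) (ballots-complete s))
... | no b≰a = contradiction p b≰a

ballots-unique : ∀ a b → Unique (ballots a b)
ballots-unique zero    zero    = [] ∷ []
ballots-unique zero    (suc b) = []
ballots-unique (suc a) zero    = Unique.map⁺ (λ { refl → refl }) (ballots-unique a 0)
ballots-unique (suc a) (suc b) with suc b ℕ.≤? suc a
... | no _  = []
... | yes p = Unique.++⁺
  (Unique.map⁺ (λ { refl → refl }) (ballots-unique a (suc b)))
  (Unique.map⁺ (λ { refl → refl }) (ballots-unique (suc a) b))
  λ (s∈tops , s∈bottoms) → disjoint (∈-map⁻ top s∈tops) (∈-map⁻ (bottom p) s∈bottoms)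
  where
  disjoint : ∀ {s} → ∃[ t ] (t ∈ ballots a (suc b) × s ≡ top t) →
    ¬ (∃[ t ] (t ∈ ballots (suc a) b × s ≡ bottom p t))
  disjoint (_ , _ , refl) (_ , _ , ())

-- The rows u and v, of lengths a and b, are increasing and partition {0, …, N - 1};
-- values beyond the lengths are junk.
record Rows (N a b : ℕ) (u v : ℕ → ℕ) : Set where
  field
    bound₁      : ∀ {i} → i < a → u i < N
    bound₂      : ∀ {i} → i < b → v i < N
    increasing₁ : ∀ {i j} → i < j → j < a → u i < u j
    increasing₂ : ∀ {i j} → i < j → j < b → v i < v j
    disjoint    : ∀ {i j} → i < a → j < b → u i ≢ v j
    cover       : ∀ {m} → m < N → (∃[ i ] i < a × u i ≡ m) ⊎ (∃[ j ] j < b × v j ≡ m)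

Columns : (b : ℕ) (u v : ℕ → ℕ) → Set
Columns b u v = ∀ {i} → i < b → u i < v i

open Rows

Rows-swap : Rows N a b u v → Rows N b a v u
Rows-swap r = record
  { bound₁ = bound₂ r ; bound₂ = bound₁ r ; increasing₁ = increasing₂ r ; increasing₂ = increasing₁ r
  ; disjoint = λ i<b j<a eq → disjoint r j<a i<b (sym eq) ; cover = λ m<N → Sum.swap (cover r m<N) }

update : (ℕ → ℕ) → ℕ → ℕ → ℕ → ℕ
update u a x i with i ℕ.≟ a
... | yes _ = x
... | no _  = u i

update-same : ∀ u a x → update u a x a ≡ x
update-same u a x with a ℕ.≟ a
... | yes _  = refl
... | no a≢a = contradiction refl a≢a

update-< : ∀ u {a} x {i} → i < a → update u a x i ≡ u i
update-< u {a} x {i} i<a with i ℕ.≟ a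
... | yes i≡a = contradiction i≡a (ℕ.<⇒≢ i<a)
... | no _    = refl

module _ {N a b u v} (r : Rows N a b u v) where

  private
    u′ : ℕ → ℕ
    u′ = update u a N
    u′a≡N : u′ a ≡ N
    u′a≡N = update-same u a N
    split : ∀ {P : ℕ → Set} → (∀ {i} → i < a → P i) → P a → ∀ {i} → i < suc a → P i
    split h ha i<1+a with ℕ.m<1+n⇒m<n∨m≡n i<1+a
    ... | inj₁ i<a  = h i<a
    ... | inj₂ refl = ha

  Rows-extend : Rows (suc N) (suc a) b u′ v
  Rows-extend = record
    { bound₁      = split {λ i → u′ i < suc N}
        (λ i<a → subst (_< suc N) (sym (update-< u N i<a)) (ℕ.m<n⇒m<1+n (bound₁ r i<a)))
        (s≤s (ℕ.≤-reflexive u′a≡N))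
    ; bound₂      = λ j<b → ℕ.m<n⇒m<1+n (bound₂ r j<b)
    ; increasing₁ = λ {i} {j} i<j j<1+a → split {λ j → ∀ {i} → i < j → u′ i < u′ j}
        (λ j<a i<j → subst₂ _<_ (sym (update-< u N (ℕ.<-trans i<j j<a))) (sym (update-< u N j<a))
                                (increasing₁ r i<j j<a))
        (λ i<a → subst₂ _<_ (sym (update-< u N i<a)) (sym u′a≡N) (bound₁ r i<a))
        j<1+a i<j
    ; increasing₂ = increasing₂ r
    ; disjoint    = λ {i} {j} i<1+a j<b → split {λ i → u′ i ≢ v j}
        (λ i<a eq → disjoint r i<a j<b (trans (sym (update-< u N i<a)) eq))
        (λ eq → ℕ.<⇒≢ (bound₂ r j<b) (trans (sym eq) u′a≡N))
        i<1+a
    ; cover       = λ m<1+N → cover′ (ℕ.m<1+n⇒m<n∨m≡n m<1+N) }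
    where
    cover′ : ∀ {m} → m < N ⊎ m ≡ N →
      (∃[ i ] i < suc a × u′ i ≡ m) ⊎ (∃[ j ] j < b × v j ≡ m)
    cover′ (inj₁ m<N)  = Sum.map₁
      (λ (i , i<a , eq) → i , ℕ.m<n⇒m<1+n i<a , trans (update-< u N i<a) eq) (cover r m<N)
    cover′ (inj₂ refl) = inj₁ (a , ℕ.n<1+n a , u′a≡N)

-- If the largest value stood before the end of the row, the last entry would exceed it.
Rows-max : Rows (suc N) (suc a) b u v → ∀ {i} → i < suc a → u i ≡ N → u a ≡ N
Rows-max {a = a} r {i} i<1+a ui≡N with ℕ.m<1+n⇒m<n∨m≡n i<1+a
... | inj₂ refl = ui≡N
... | inj₁ i<a  = contradiction (bound₁ r (ℕ.n<1+n a))
  (ℕ.≤⇒≯ (subst (λ m → suc m ≤ _) ui≡N (increasing₁ r i<a (ℕ.n<1+n a))))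

Rows-restrict : Rows (suc N) (suc a) b u v → u a ≡ N → Rows N a b u v
Rows-restrict {N} {a} {b} {u} {v} r ua≡N = record
  { bound₁      = λ i<a → subst (_ <_) ua≡N (increasing₁ r i<a (ℕ.n<1+n a))
  ; bound₂      = λ j<b → ℕ.≤∧≢⇒< (ℕ.s≤s⁻¹ (bound₂ r j<b))
      (λ eq → disjoint r (ℕ.n<1+n a) j<b (trans ua≡N (sym eq)))
  ; increasing₁ = λ i<j j<a → increasing₁ r i<j (ℕ.m<n⇒m<1+n j<a)
  ; increasing₂ = increasing₂ r
  ; disjoint    = λ i<a → disjoint r (ℕ.m<n⇒m<1+n i<a)
  ; cover       = λ m<N → Sum.map₁ (restrict m<N) (cover r (ℕ.m<n⇒m<1+n m<N)) }
  where
  restrict : ∀ {m} → m < N → ∃[ i ] i < suc a × u i ≡ m → ∃[ i ] i < a × u i ≡ m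
  restrict m<N (i , i<1+a , eq) with ℕ.m<1+n⇒m<n∨m≡n i<1+a
  ... | inj₁ i<a  = i , i<a , eq
  ... | inj₂ refl = contradiction (trans (sym eq) ua≡N) (ℕ.<⇒≢ m<N)

-- Entries count from 0, so the value written at a step is `a + b`, the number of entries already
-- placed.
row₁ row₂ : Ballot a b → ℕ → ℕ
row₁ []                   = λ _ → 0
row₁ (top {a} {b} s)      = update (row₁ s) a (a ℕ.+ b)
row₁ (bottom _ s)         = row₁ s
row₂ []                   = λ _ → 0
row₂ (top s)              = row₂ s
row₂ (bottom {a} {b} _ s) = update (row₂ s) b (a ℕ.+ b)

Ballot⇒Rows : (s : Ballot a b) → Rows (a ℕ.+ b) a b (row₁ s) (row₂ s)
Ballot⇒Rows [] = record
  { bound₁ = λ () ; bound₂ = λ () ; increasing₁ = λ _ () ; increasing₂ = λ _ () ; disjoint = λ () ; cover = λ () }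
Ballot⇒Rows (top s) = Rows-extend (Ballot⇒Rows s)
Ballot⇒Rows (bottom {a} {b} _ s) = subst
  (λ N → Rows N a (suc b) (row₁ s) (update (row₂ s) b (a ℕ.+ b))) (sym (ℕ.+-suc a b))
  (Rows-swap (Rows-extend (Rows-swap (Ballot⇒Rows s))))

Ballot⇒Columns : (s : Ballot a b) → Columns b (row₁ s) (row₂ s)
Ballot⇒Columns (top {a} {b} s) {i} i<b =
  subst (_< row₂ s i) (sym (update-< (row₁ s) (a ℕ.+ b) (ℕ.<-≤-trans i<b (Ballot⇒≤ s)))) (Ballot⇒Columns s i<b)
Ballot⇒Columns (bottom {a} {b} b<a s) {i} i<1+b with ℕ.m<1+n⇒m<n∨m≡n i<1+b
... | inj₁ i<b  = subst (row₁ s i <_) (sym (update-< (row₂ s) (a ℕ.+ b) i<b)) (Ballot⇒Columns s i<b)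
... | inj₂ refl = subst (row₁ s b <_) (sym (update-same (row₂ s) b (a ℕ.+ b))) (bound₁ (Ballot⇒Rows s) b<a)

infix 4 _≗_below_
_≗_below_ : (ℕ → ℕ) → (ℕ → ℕ) → ℕ → Set
u ≗ v below a = ∀ {i} → i < a → u i ≡ v i

update-≗ : ∀ {u v a x} → u ≗ v below a → v a ≡ x → update u a x ≗ v below suc a
update-≗ {u} {v} {a} {x} u≗v va≡x i<1+a with ℕ.m<1+n⇒m<n∨m≡n i<1+a
... | inj₁ i<a  = trans (update-< u x i<a) (u≗v i<a)
... | inj₂ refl = trans (update-same u a x) (sym va≡x)

-- The largest entry ends one of the two rows.
Rows⇒Ballot : ∀ a b {u v} → b ≤ a → Rows (a ℕ.+ b) a b u v → Columns b u v →
  ∃[ s ] row₁ {a} {b} s ≗ u below a × row₂ s ≗ v below b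
Rows⇒Ballot zero    zero _ _ _ = [] , (λ ()) , λ ()
Rows⇒Ballot (suc a) b {u} {v} b≤1+a r c with cover r (ℕ.n<1+n (a ℕ.+ b))
... | inj₁ (i , i<1+a , ui≡max) =
  let s , eq₁ , eq₂ = Rows⇒Ballot a b b≤a (Rows-restrict r ua≡max) c
  in top s , update-≗ eq₁ ua≡max , eq₂
  where
  ua≡max : u a ≡ a ℕ.+ b
  ua≡max = Rows-max r i<1+a ui≡max
  b≤a : b ≤ a
  -- If the second row reached column `a`, its entry there would have to exceed the maximum above
  -- it; so the shape left after removing the maximum is again a partition.
  b≤a = ℕ.≮⇒≥ λ a<b → ℕ.<-irrefl refl
    (ℕ.<-≤-trans (subst (_< v a) ua≡max (c a<b)) (ℕ.s≤s⁻¹ (bound₂ r a<b)))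
Rows⇒Ballot (suc a) (suc b) {u} {v} b<1+a r c | inj₂ (j , j<1+b , vj≡max) =
  let s , eq₁ , eq₂ = Rows⇒Ballot (suc a) b (ℕ.<⇒≤ b<1+a)
        (Rows-swap (Rows-restrict r′ vb≡max)) (λ i<b → c (ℕ.m<n⇒m<1+n i<b))
  in bottom b<1+a s , eq₁ , update-≗ eq₂ vb≡max
  where
  r′ : Rows (suc (suc a ℕ.+ b)) (suc b) (suc a) v u
  r′ = Rows-swap (subst (λ N → Rows N (suc a) (suc b) u v) (cong suc (ℕ.+-suc a b)) r)
  vb≡max : v b ≡ suc a ℕ.+ b
  vb≡max = Rows-max r′ j<1+b (trans vj≡max (ℕ.+-suc a b))

≗-update : ∀ {u v a x} → update u a x ≗ update v a x below suc a → u ≗ v below a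
≗-update {u} {v} {a} {x} eq i<a =
  trans (sym (update-< u x i<a)) (trans (eq (ℕ.m<n⇒m<1+n i<a)) (update-< v x i<a))

-- A last step `top` puts the maximum at the end of the first row, whereas before a last step
-- `bottom` all entries of that row are smaller than the maximum.
top≢bottom : ∀ {a b} (s : Ballot a (suc b)) (t : Ballot (suc a) b) →
  row₁ (top s) a ≢ row₁ t a
top≢bottom {a} {b} s t eq = ℕ.<⇒≢ (bound₁ (Ballot⇒Rows t) (ℕ.n<1+n a))
  (trans (sym eq) (trans (update-same (row₁ s) a _) (ℕ.+-suc a b)))

rows-injective : (s t : Ballot a b) → row₁ s ≗ row₁ t below a → row₂ s ≗ row₂ t below b → s ≡ t
rows-injective []           []           _   _   = refl
rows-injective (top s)      (top t)      eq₁ eq₂ = cong top (rows-injective s t (≗-update eq₁) eq₂)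
rows-injective (bottom p s) (bottom q t) eq₁ eq₂ =
  cong₂ bottom (ℕ.≤-irrelevant p q) (rows-injective s t eq₁ (≗-update eq₂))
rows-injective (top s)      (bottom q t) eq₁ _   = contradiction (eq₁ (ℕ.n<1+n _)) (top≢bottom s t)
rows-injective (bottom p s) (top t)      eq₁ _   = contradiction (sym (eq₁ (ℕ.n<1+n _))) (top≢bottom t s)

-- Fillings as pairs of functions on the natural numbers

at : Vec (Fin N) a → ℕ → ℕ
at []       _       = 0
at (x ∷ xs) zero    = toℕ x
at (x ∷ xs) (suc i) = at xs i

at-toℕ : (xs : Vec (Fin N) a) (j : Fin a) → at xs (toℕ j) ≡ toℕ (lookup xs j)
at-toℕ (x ∷ xs) zero    = refl
at-toℕ (x ∷ xs) (suc j) = at-toℕ xs j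

at-fromℕ< : (xs : Vec (Fin N) a) {i : ℕ} (i<a : i < a) → at xs i ≡ toℕ (lookup xs (fromℕ< i<a))
at-fromℕ< xs i<a = trans (cong (at xs) (sym (Fin.toℕ-fromℕ< i<a))) (at-toℕ xs (fromℕ< i<a))

at-injective : (xs ys : Vec (Fin N) a) → at xs ≗ at ys below a → xs ≡ ys
at-injective []       []       _  = refl
at-injective (x ∷ xs) (y ∷ ys) eq =
  cong₂ _∷_ (Fin.toℕ-injective (eq (s≤s z≤n))) (at-injective xs ys (λ i<a → eq (s≤s i<a)))

fill : (u : ℕ → ℕ) → (∀ {i} → i < a → u i < N) → Vec (Fin N) a
fill u bound = Vec.tabulate λ j → fromℕ< (bound (Fin.toℕ<n j))

at-fill : ∀ (u : ℕ → ℕ) (bound : ∀ {i} → i < a → u i < N) → at (fill u bound) ≗ u below a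
at-fill u bound i<a = trans (at-fromℕ< (fill u bound) i<a)
  (trans (cong toℕ (Vec.lookup∘tabulate _ (fromℕ< i<a)))
  (trans (Fin.toℕ-fromℕ< _) (cong u (Fin.toℕ-fromℕ< i<a))))

Rows-≗ : ∀ {u′ v′} → u ≗ u′ below a → v ≗ v′ below b → Rows N a b u v → Rows N a b u′ v′
Rows-≗ eq₁ eq₂ r = record
  { bound₁      = λ i<a → subst (_< _) (eq₁ i<a) (bound₁ r i<a)
  ; bound₂      = λ j<b → subst (_< _) (eq₂ j<b) (bound₂ r j<b)
  ; increasing₁ = λ i<j j<a → subst₂ _<_ (eq₁ (ℕ.<-trans i<j j<a)) (eq₁ j<a) (increasing₁ r i<j j<a)
  ; increasing₂ = λ i<j j<b → subst₂ _<_ (eq₂ (ℕ.<-trans i<j j<b)) (eq₂ j<b) (increasing₂ r i<j j<b)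
  ; disjoint    = λ i<a j<b eq → disjoint r i<a j<b (trans (eq₁ i<a) (trans eq (sym (eq₂ j<b))))
  ; cover       = λ m<N → Sum.map (λ (i , i<a , eq) → i , i<a , trans (sym (eq₁ i<a)) eq)
                                  (λ (j , j<b , eq) → j , j<b , trans (sym (eq₂ j<b)) eq) (cover r m<N) }

increasing⇒injective : (∀ {i j} → i < j → j < a → u i < u j) → ∀ {i j} → i < a → j < a → u i ≡ u j → i ≡ j
increasing⇒injective inc {i} {j} i<a j<a eq with ℕ.<-cmp i j
... | tri< i<j _ _ = contradiction eq (ℕ.<⇒≢ (inc i<j j<a))
... | tri≈ _ i≡j _ = i≡j
... | tri> _ _ j<i = contradiction (sym eq) (ℕ.<⇒≢ (inc j<i i<a))

shape : ℕ → ℕ → Shape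
shape a b = a ∷ b ∷ []

-- The form to which `sum (shape a b)` computes, trailing zero included.
size : ℕ → ℕ → ℕ
size a b = a ℕ.+ (b ℕ.+ 0)

module _ {a b} (xs : Vec (Fin (size a b)) a) (ys : Vec (Fin (size a b)) b) where

  private
    T : Filling (size a b) (shape a b)
    T = xs ∷ ys ∷ []

    top-cell : ∀ {i} → i < a → Cell (shape a b)
    top-cell i<a = zero , fromℕ< i<a

    bottom-cell : ∀ {i} → i < b → Cell (shape a b)
    bottom-cell i<b = suc zero , fromℕ< i<b

    fromℕ<-mono : ∀ {m i j} (i<m : i < m) (j<m : j < m) → i < j → fromℕ< i<m Fin.< fromℕ< j<m
    fromℕ<-mono i<m j<m i<j = subst₂ _<_ (sym (Fin.toℕ-fromℕ< i<m)) (sym (Fin.toℕ-fromℕ< j<m)) i<j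

  IsStandard⇒Rows : IsStandard T → Rows (size a b) a b (at xs) (at ys)
  IsStandard⇒Rows ((inj , surj) , rows , _) = record
    { bound₁      = λ i<a → subst (_< size a b) (sym (at-fromℕ< xs i<a)) (Fin.toℕ<n _)
    ; bound₂      = λ j<b → subst (_< size a b) (sym (at-fromℕ< ys j<b)) (Fin.toℕ<n _)
    ; increasing₁ = λ i<j j<a → let i<a = ℕ.<-trans i<j j<a in
        subst₂ _<_ (sym (at-fromℕ< xs i<a)) (sym (at-fromℕ< xs j<a)) (rows zero _ _ (fromℕ<-mono i<a j<a i<j))
    ; increasing₂ = λ i<j j<b → let i<b = ℕ.<-trans i<j j<b in
        subst₂ _<_ (sym (at-fromℕ< ys i<b)) (sym (at-fromℕ< ys j<b)) (rows (suc zero) _ _ (fromℕ<-mono i<b j<b i<j))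
    ; disjoint    = λ i<a j<b eq → different (inj {top-cell i<a} {bottom-cell j<b}
        (Fin.toℕ-injective (trans (sym (at-fromℕ< xs i<a)) (trans eq (at-fromℕ< ys j<b)))))
    ; cover       = λ m<N → find m<N (surj (fromℕ< m<N)) }
    where
    different : ∀ {i j} → ¬ (_≡_ {A = Cell (shape a b)} (zero , i) (suc zero , j))
    different ()
    find : ∀ {m} (m<N : m < size a b) → ∃[ c ] (∀ {c′} → c′ ≡ c → entry T c′ ≡ fromℕ< m<N) →
      (∃[ i ] i < a × at xs i ≡ m) ⊎ (∃[ j ] j < b × at ys j ≡ m)
    find m<N ((zero , i) , eq) = inj₁ (toℕ i , Fin.toℕ<n i ,
      trans (at-toℕ xs i) (trans (cong toℕ (eq refl)) (Fin.toℕ-fromℕ< m<N)))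
    find m<N ((suc zero , j) , eq) = inj₂ (toℕ j , Fin.toℕ<n j ,
      trans (at-toℕ ys j) (trans (cong toℕ (eq refl)) (Fin.toℕ-fromℕ< m<N)))

  IsStandard⇒Columns : b ≤ a → IsStandard T → Columns b (at xs) (at ys)
  IsStandard⇒Columns b≤a (_ , _ , columns) i<b = let i<a = ℕ.<-≤-trans i<b b≤a in
    subst₂ _<_ (sym (at-fromℕ< xs i<a)) (sym (at-fromℕ< ys i<b))
      (columns zero (suc zero) (fromℕ< i<a) (fromℕ< i<b) (s≤s z≤n)
        (trans (Fin.toℕ-fromℕ< i<a) (sym (Fin.toℕ-fromℕ< i<b))))

  Rows∧Columns⇒IsStandard : Rows (size a b) a b (at xs) (at ys) → Columns b (at xs) (at ys) → IsStandard T
  Rows∧Columns⇒IsStandard r c = ((λ {c₁} {c₂} → injective c₁ c₂) , surjective) , rows , columns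
    where
    values : ∀ {m n} {zs : Vec (Fin (size a b)) m} {ws : Vec (Fin (size a b)) n} i j →
      lookup zs i ≡ lookup ws j → at zs (toℕ i) ≡ at ws (toℕ j)
    values {zs = zs} {ws} i j eq = trans (at-toℕ zs i) (trans (cong toℕ eq) (sym (at-toℕ ws j)))

    injective : ∀ c₁ c₂ → entry T c₁ ≡ entry T c₂ → c₁ ≡ c₂
    injective (zero , i) (zero , j) eq = cong (zero ,_) (Fin.toℕ-injective
      (increasing⇒injective (increasing₁ r) (Fin.toℕ<n i) (Fin.toℕ<n j) (values {zs = xs} {xs} i j eq)))
    injective (suc zero , i) (suc zero , j) eq = cong (suc zero ,_) (Fin.toℕ-injective
      (increasing⇒injective (increasing₂ r) (Fin.toℕ<n i) (Fin.toℕ<n j) (values {zs = ys} {ys} i j eq)))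
    injective (zero , i) (suc zero , j) eq =
      contradiction (values {zs = xs} {ys} i j eq) (disjoint r (Fin.toℕ<n i) (Fin.toℕ<n j))
    injective (suc zero , i) (zero , j) eq =
      contradiction (sym (values {zs = ys} {xs} i j eq)) (disjoint r (Fin.toℕ<n j) (Fin.toℕ<n i))

    surjective : ∀ y → ∃[ c ] (∀ {c′} → c′ ≡ c → entry T c′ ≡ y)
    surjective y with cover r (Fin.toℕ<n y)
    ... | inj₁ (i , i<a , eq) = top-cell i<a ,
      λ { refl → Fin.toℕ-injective (trans (sym (at-fromℕ< xs i<a)) eq) }
    ... | inj₂ (j , j<b , eq) = bottom-cell j<b ,
      λ { refl → Fin.toℕ-injective (trans (sym (at-fromℕ< ys j<b)) eq) }

    rows : RowIncreasing T
    rows zero       j j′ j<j′ = subst₂ _<_ (at-toℕ xs j) (at-toℕ xs j′) (increasing₁ r j<j′ (Fin.toℕ<n j′))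
    rows (suc zero) j j′ j<j′ = subst₂ _<_ (at-toℕ ys j) (at-toℕ ys j′) (increasing₂ r j<j′ (Fin.toℕ<n j′))

    columns : ColumnIncreasing T
    columns zero       (suc zero) j j′ _ eq = subst₂ _<_
      (trans (cong (at xs) (sym eq)) (at-toℕ xs j)) (at-toℕ ys j′) (c (Fin.toℕ<n j′))
    columns (suc zero) (suc zero) j j′ (s≤s ()) _

size≡ : ∀ a b → a ℕ.+ b ≡ size a b
size≡ a b = cong (a ℕ.+_) (sym (ℕ.+-identityʳ b))

Ballot⇒Rows-size : (s : Ballot a b) → Rows (size a b) a b (row₁ s) (row₂ s)
Ballot⇒Rows-size {a} {b} s = subst (λ N → Rows N a b (row₁ s) (row₂ s)) (size≡ a b) (Ballot⇒Rows s)

filling : Ballot a b → Filling (size a b) (shape a b)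
filling s = fill (row₁ s) (bound₁ (Ballot⇒Rows-size s)) ∷ fill (row₂ s) (bound₂ (Ballot⇒Rows-size s)) ∷ []

module _ (s : Ballot a b) where
  private
    r = Ballot⇒Rows-size s

  at-row₁ : at (fill (row₁ s) (bound₁ r)) ≗ row₁ s below a
  at-row₁ = at-fill (row₁ s) (bound₁ r)

  at-row₂ : at (fill (row₂ s) (bound₂ r)) ≗ row₂ s below b
  at-row₂ = at-fill (row₂ s) (bound₂ r)

  filling-standard : IsStandard (filling s)
  filling-standard = Rows∧Columns⇒IsStandard _ _
    (Rows-≗ (λ i<a → sym (at-row₁ i<a)) (λ j<b → sym (at-row₂ j<b)) r)
    (λ i<b → subst₂ _<_ (sym (at-row₁ (ℕ.<-≤-trans i<b (Ballot⇒≤ s)))) (sym (at-row₂ i<b)) (Ballot⇒Columns s i<b))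

∷-injective : ∀ {N a b} {xs xs′ : Vec (Fin N) a} {ys ys′ : Vec (Fin N) b} →
  _≡_ {A = Filling N (shape a b)} (xs ∷ ys ∷ []) (xs′ ∷ ys′ ∷ []) → xs ≡ xs′ × ys ≡ ys′
∷-injective refl = refl , refl

filling-injective : {s t : Ballot a b} → filling s ≡ filling t → s ≡ t
filling-injective {s = s} {t} eq with eq₁ , eq₂ ← ∷-injective eq = rows-injective s t
  (λ {i} i<a → trans (sym (at-row₁ s i<a)) (trans (cong (λ xs → at xs i) eq₁) (at-row₁ t i<a)))
  (λ {j} j<b → trans (sym (at-row₂ s j<b)) (trans (cong (λ ys → at ys j) eq₂) (at-row₂ t j<b)))

filling-surjective : b ≤ a → ∀ T → IsStandard {shape a b} T → ∃[ s ] T ≡ filling s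
filling-surjective {b} {a} b≤a (xs ∷ ys ∷ []) standard
  with s , eq₁ , eq₂ ← Rows⇒Ballot a b b≤a
         (subst (λ N → Rows N a b (at xs) (at ys)) (sym (size≡ a b)) (IsStandard⇒Rows xs ys standard))
         (IsStandard⇒Columns xs ys b≤a standard)
  = s , cong₂ (λ xs ys → xs ∷ ys ∷ [])
      (at-injective xs _ (λ i<a → sym (trans (at-row₁ s i<a) (eq₁ i<a))))
      (at-injective ys _ (λ j<b → sym (trans (at-row₂ s j<b) (eq₂ j<b))))

-- Counting the standard fillings

allVecs-complete : ∀ {A : Set} {xs : List A} → (∀ x → x ∈ xs) → ∀ {n} (v : Vec A n) → v ∈ allVecs xs n
allVecs-complete complete []       = here refl
allVecs-complete complete (x ∷ xs) =
  ∈-cartesianProductWith⁺ _∷_ (complete x) (allVecs-complete complete xs)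

allVecs-unique : ∀ {A : Set} {xs : List A} → Unique xs → ∀ n → Unique (allVecs xs n)
allVecs-unique unique zero    = [] ∷ []
allVecs-unique unique (suc n) =
  Unique.cartesianProductWith⁺ _∷_ Vec.∷-injective unique (allVecs-unique unique n)

allFillings-complete : ∀ {N λs} (T : Filling N λs) → T ∈ allFillings N λs
allFillings-complete []      = here refl
allFillings-complete (v ∷ T) =
  ∈-cartesianProductWith⁺ _∷_ (allVecs-complete ∈-allFin v) (allFillings-complete T)

allFillings-unique : ∀ N λs → Unique (allFillings N λs)
allFillings-unique N []       = [] ∷ []
allFillings-unique N (r ∷ λs) = Unique.cartesianProductWith⁺ _∷_ (λ { refl → refl , refl })
  (allVecs-unique (Unique.allFin⁺ N) r) (allFillings-unique N λs)

-- The filtered list of fillings and the image of `ballots a b` under `filling` are free of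
-- repetitions and have the same members, so one is a permutation of the other.
f^≡length-ballots : b ≤ a → f^ (a ∷ b ∷ []) ≡ List.length (ballots a b)
f^≡length-ballots {b} {a} b≤a = trans
  (↭-length (∼bag⇒↭ (unique∧set⇒bag
    (Unique.filter⁺ isStandard? (allFillings-unique (size a b) (shape a b)))
    (Unique.map⁺ filling-injective (ballots-unique a b))
    (mk⇔ to from))))
  (List.length-map filling (ballots a b))
  where
  to : ∀ {T} → T ∈ List.filter isStandard? (allFillings (size a b) (shape a b)) →
    T ∈ List.map filling (ballots a b)
  to {T} T∈ with s , refl ← filling-surjective b≤a T
    (proj₂ (∈-filter⁻ isStandard? {xs = allFillings (size a b) (shape a b)} T∈)) =
    ∈-map⁺ filling (ballots-complete s)
  from : ∀ {T} → T ∈ List.map filling (ballots a b) →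
    T ∈ List.filter isStandard? (allFillings (size a b) (shape a b))
  from T∈ with s , _ , refl ← ∈-map⁻ filling T∈ =
    ∈-filter⁺ isStandard? (allFillings-complete (filling s)) (filling-standard s)

-- Coefficients of the Hilbert series

applyUpTo-sum-zero : ∀ n → sum (List.applyUpTo (λ _ → 0) n) ≡ 0
applyUpTo-sum-zero zero    = refl
applyUpTo-sum-zero (suc n) = applyUpTo-sum-zero n

sum-·q^-< : ∀ (c : ℕ → ℕ) {j m} → j < m → sum (List.applyUpTo (λ k → (c k ·q^ k) j) m) ≡ c j
sum-·q^-< c {zero}  {suc m} _ = trans (cong (c 0 ℕ.+_) (applyUpTo-sum-zero m)) (ℕ.+-identityʳ (c 0))
sum-·q^-< c {suc j} {suc m} j<m = sum-·q^-< (c ∘ suc) (ℕ.s<s⁻¹ j<m)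

sum-·q^-≥ : ∀ (c : ℕ → ℕ) {j m} → m ≤ j → sum (List.applyUpTo (λ k → (c k ·q^ k) j) m) ≡ 0
sum-·q^-≥ c {j}     {zero}  _ = refl
sum-·q^-≥ c {suc j} {suc m} m≤j = sum-·q^-≥ (c ∘ suc) (ℕ.s≤s⁻¹ m≤j)

≤⌊n/2⌋⇒≤∸ : ∀ {n k} → k ≤ ⌊ n /2⌋ → k ≤ n ∸ k
≤⌊n/2⌋⇒≤∸ {n} {k} k≤ = ℕ.m+n≤o⇒m≤o∸n k (begin
  k ℕ.+ k               ≤⟨ ℕ.+-mono-≤ k≤ (ℕ.≤-trans k≤ (ℕ.⌊n/2⌋≤⌈n/2⌉ n)) ⟩
  ⌊ n /2⌋ ℕ.+ ⌈ n /2⌉   ≡⟨ ℕ.⌊n/2⌋+⌈n/2⌉≡n n ⟩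
  n                     ∎)
  where open ℕ.≤-Reasoning

⌊n/2⌋<⇒<2* : ∀ {n k} → ⌊ n /2⌋ < k → n < 2 ℕ.* k
⌊n/2⌋<⇒<2* {n} {k} <k = begin-strict
  n                     ≡⟨ ℕ.⌊n/2⌋+⌈n/2⌉≡n n ⟨
  ⌊ n /2⌋ ℕ.+ ⌈ n /2⌉   <⟨ ℕ.+-mono-<-≤ <k (ℕ.≤-trans (ℕ.⌊n/2⌋-mono (ℕ.n≤1+n (suc n))) <k) ⟩
  k ℕ.+ k               ≡⟨ cong (k ℕ.+_) (ℕ.+-identityʳ k) ⟨
  2 ℕ.* k               ∎
  where open ℕ.≤-Reasoning

HasDim-coefficient : ∀ {n} {P : R n → Set} (c : ℕ → ℕ) m k →
  (k ≤ m → HasDim P (c k)) → (m < k → HasDim P 0) → HasDim P ((∑[k≤ m ] (λ k → c k ·q^ k)) k)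
HasDim-coefficient {P = P} c m k dim≤ dim> with k ℕ.≤? m
... | yes k≤m = subst (HasDim P) (sym (sum-·q^-< c (s≤s k≤m))) (dim≤ k≤m)
... | no k≰m  = subst (HasDim P) (sym (sum-·q^-≥ c (ℕ.≰⇒> k≰m))) (dim> (ℕ.≰⇒> k≰m))

corollary4p4 : (n : ℕ) → 1 ≤ n →
    HasHilb (EQH n) (∑[k≤ ⌊ n /2⌋ ] (λ k → (f^ (n ∸ k ∷ k ∷ [])) ·q^ k))
corollary4p4 n 1≤n k = HasDim-coefficient (λ k → f^ (n ∸ k ∷ k ∷ [])) ⌊ n /2⌋ k
  (λ k≤ → subst (HasDim _) (sym (f^≡length-ballots (≤⌊n/2⌋⇒≤∸ k≤)))
    (HasDim-Λ (EQH∩Homogeneous⇔Harmonic k 1≤n)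
      (dim-Harmonic n (n ∸ k) k 0 (sym (ℕ.m∸n+n≡m (ℕ.≤-trans k≤ (ℕ.⌊n/2⌋≤n n)))))))
  (λ k> → HasDim-Λ (EQH∩Homogeneous⇔Harmonic k 1≤n)
    (Dim-zero λ v → Harmonic-vanish
      (subst (_< 2 ℕ.* k) (sym (ℕ.+-identityʳ n)) (⌊n/2⌋<⇒<2* k>))))
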